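{- Consider $\mathsf{CountSketch}$ applied to a vector $x\in\mathbb{R}^U$ with $\ell=5$ rows and $r$ buckets per row, with the median decoder (and fully independent hash values and signs). Then for any distinct $u\neq v\in[U]$, $$\big|\mathbb{E}[\mathrm{err}(u)\cdot\mathrm{err}(v)]\big| \le \frac{70}{r^3}\,\|x\|_1^2 .$$ In particular, setting $r=\lceil 1/\varepsilon\rceil$ for $\varepsilon>0$ gives $|\mathbb{E}[\mathrm{err}(u)\cdot\mathrm{err}(v)]|\le 70\,\varepsilon^3\|x\|_1^2$.
   Context: $\mathsf{CountSketch}$ with $\ell$ rows and $r$ buckets per row: for each row $a\in[\ell]$ there is a hash function $h_a:[U]\to[r]$ and signs $\sigma_{a,w}\in\{ -1,1\}$, $w\in[U]$. Full independence is assumed: all hash values $h_a(w)$ ($a\in[\ell]$, $w\in[U]$) are i.i.d. uniform on $[r]$, all signs $\sigma_{a,w}$ are i.i.d. uniform on $\{ -1,1\}$, and hashes and signs are mutually independent. The counters are $C_{a,b}=\sum_{w:\,h_a(w)=b}\sigma_{a,w}x_w$. The row estimator of $x_u$ is $\widehat x^{(a)}_u=\sigma_{a,u}C_{a,h_a(u)}$ and the (median-decoded) estimator is $\widehat x_u=\mathrm{median}(\widehat x_u^{(1)},\dots,\widehat x_u^{(\ell)})$. Equivalently, with $$Y_{a,u}:=\sum_{w\ne u:\ h_a(w)=h_a(u)}\sigma_{a,u}\sigma_{a,w}x_w,$$ the error is $\mathrm{err}(u):=\widehat x_u-x_u=\mathrm{median}(Y_{1,u},\dots,Y_{\ell,u})$.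 -}

module Defs where

open import Data.Bool.Base using (if_then_else_)
open import Data.Fin.Base using (Fin; fromℕ<)
open import Data.Fin.Properties using (_≟_)
import Data.Integer.Base as ℤ
open import Data.List.Base using (List; []; _∷_; length; map; foldr; allFin; cartesianProductWith)
open import Data.Nat.Base as ℕ using (ℕ; zero; suc; s≤s; ⌊_/2⌋)
import Data.Nat.Properties as ℕₚ
open import Data.Product.Base using (∃-syntax; _×_; _,_)
open import Data.Rational.Base as ℚ using (ℚ; 0ℚ; 1ℚ; ½)
import Data.Rational.Properties as ℚₚ
open import Data.Rational.Solver using (module +-*-Solver)
open import Data.Sign.Base as Sign using (Sign)
open import Data.Sum.Base using (inj₁; inj₂)
open import Data.Vec.Base as Vec using (Vec)
import Data.Vec.Functional as Vector
open import Relation.Binary.PropositionalEquality using (_≡_; refl; sym; trans; cong; cong₂; subst)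
open import Relation.Nullary.Decidable using (does)

------------------------------------------------------------------------
-- Estimates on rationals, used to build the operations on ℝ

private
  dist : ℚ → ℚ → ℚ
  dist p q = ℚ.∣ p ℚ.- q ∣

  ∣∣≤ : ∀ {p e} → p ℚ.≤ e → ℚ.- p ℚ.≤ e → ℚ.∣ p ∣ ℚ.≤ e
  ∣∣≤ {p} {e} p≤e -p≤e with ℚₚ.∣p∣≡p∨∣p∣≡-p p
  ... | inj₁ eq = subst (ℚ._≤ e) (sym eq) p≤e
  ... | inj₂ eq = subst (ℚ._≤ e) (sym eq) -p≤e

  p≤∣p∣ : ∀ p → p ℚ.≤ ℚ.∣ p ∣
  p≤∣p∣ p with ℚₚ.≤-total 0ℚ p
  ... | inj₁ 0≤p = ℚₚ.≤-reflexive (sym (ℚₚ.0≤p⇒∣p∣≡p 0≤p))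
  ... | inj₂ p≤0 = ℚₚ.≤-trans p≤0 (ℚₚ.0≤∣p∣ p)

  p-q+q≡p : ∀ p q → q ℚ.+ (p ℚ.- q) ≡ p
  p-q+q≡p = solve 2 (λ p q → q :+ (p :- q) := p) refl
    where open +-*-Solver

  neg-sub : ∀ p q → ℚ.- (p ℚ.- q) ≡ q ℚ.- p
  neg-sub = solve 2 (λ p q → :- (p :- q) := q :- p) refl
    where open +-*-Solver

  ≤-shift : ∀ {p q e} → p ℚ.≤ q ℚ.+ e → p ℚ.- q ℚ.≤ e
  ≤-shift {p} {q} {e} p≤q+e =
    subst (p ℚ.- q ℚ.≤_) (lem q e) (ℚₚ.+-monoˡ-≤ (ℚ.- q) p≤q+e)
    where
    open +-*-Solver
    lem : ∀ q e → (q ℚ.+ e) ℚ.- q ≡ e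
    lem = solve 2 (λ q e → (q :+ e) :- q := e) refl

  dist-sym : ∀ p q → dist p q ≡ dist q p
  dist-sym p q = trans (sym (ℚₚ.∣-p∣≡∣p∣ (p ℚ.- q))) (cong ℚ.∣_∣ (neg-sub p q))

  dist≤ : ∀ {p q e} → p ℚ.≤ q ℚ.+ e → q ℚ.≤ p ℚ.+ e → dist p q ℚ.≤ e
  dist≤ {p} {q} {e} p≤ q≤ =
    ∣∣≤ (≤-shift p≤) (subst (ℚ._≤ e) (sym (neg-sub p q)) (≤-shift q≤))

  ≤+dist : ∀ p q → p ℚ.≤ q ℚ.+ dist p q
  ≤+dist p q = subst (ℚ._≤ q ℚ.+ dist p q) (p-q+q≡p p q)
                     (ℚₚ.+-monoʳ-≤ q (p≤∣p∣ (p ℚ.- q)))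

  ≤+≤ˡ : ∀ {p q} → 0ℚ ℚ.≤ q → p ℚ.≤ p ℚ.+ q
  ≤+≤ˡ {p} {q} 0≤q = subst (ℚ._≤ p ℚ.+ q) (ℚₚ.+-identityʳ p) (ℚₚ.+-monoʳ-≤ p 0≤q)

  ≤+≤ʳ : ∀ {p q} → 0ℚ ℚ.≤ q → p ℚ.≤ q ℚ.+ p
  ≤+≤ʳ {p} {q} 0≤q = subst (ℚ._≤ q ℚ.+ p) (ℚₚ.+-identityˡ p) (ℚₚ.+-monoˡ-≤ p 0≤q)

  Lipschitz₁ : (ℚ → ℚ) → Set
  Lipschitz₁ f = ∀ p q → dist (f p) (f q) ℚ.≤ dist p q

  Lipschitz₂ : (ℚ → ℚ → ℚ) → Set
  Lipschitz₂ f = ∀ p p′ q q′ → dist (f p q) (f p′ q′) ℚ.≤ dist p p′ ℚ.+ dist q q′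

  neg-lipschitz : Lipschitz₁ (λ p → ℚ.- p)
  neg-lipschitz p q = ℚₚ.≤-reflexive (trans (cong ℚ.∣_∣ (lem p q)) (ℚₚ.∣-p∣≡∣p∣ (p ℚ.- q)))
    where
    open +-*-Solver
    lem : ∀ p q → ℚ.- p ℚ.- (ℚ.- q) ≡ ℚ.- (p ℚ.- q)
    lem = solve 2 (λ p q → :- p :- (:- q) := :- (p :- q)) refl

  abs-lipschitz : Lipschitz₁ ℚ.∣_∣
  abs-lipschitz p q = dist≤ (half p q)
    (subst (λ d → ℚ.∣ q ∣ ℚ.≤ ℚ.∣ p ∣ ℚ.+ d) (dist-sym q p) (half q p))
    where
    half : ∀ p q → ℚ.∣ p ∣ ℚ.≤ ℚ.∣ q ∣ ℚ.+ dist p q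
    half p q = subst (λ z → ℚ.∣ z ∣ ℚ.≤ ℚ.∣ q ∣ ℚ.+ dist p q) (p-q+q≡p p q)
                     (ℚₚ.∣p+q∣≤∣p∣+∣q∣ q (p ℚ.- q))

  +-lipschitz : Lipschitz₂ ℚ._+_
  +-lipschitz p p′ q q′ =
    subst (λ z → ℚ.∣ z ∣ ℚ.≤ dist p p′ ℚ.+ dist q q′) (lem p p′ q q′)
          (ℚₚ.∣p+q∣≤∣p∣+∣q∣ (p ℚ.- p′) (q ℚ.- q′))
    where
    open +-*-Solver
    lem : ∀ p p′ q q′ → (p ℚ.- p′) ℚ.+ (q ℚ.- q′) ≡ (p ℚ.+ q) ℚ.- (p′ ℚ.+ q′)
    lem = solve 4 (λ p p′ q q′ → (p :- p′) :+ (q :- q′) := (p :+ q) :- (p′ :+ q′)) refl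

  shift-mono₂ : ∀ f → (∀ {p p′ q q′} → p ℚ.≤ p′ → q ℚ.≤ q′ → f p q ℚ.≤ f p′ q′) →
                (∀ p q e → f (p ℚ.+ e) (q ℚ.+ e) ≡ f p q ℚ.+ e) → Lipschitz₂ f
  shift-mono₂ f mono equivariant p p′ q q′ = dist≤ (half p p′ q q′)
    (subst (λ d → f p′ q′ ℚ.≤ f p q ℚ.+ d) (cong₂ ℚ._+_ (dist-sym p′ p) (dist-sym q′ q))
           (half p′ p q′ q))
    where
    half : ∀ p p′ q q′ → f p q ℚ.≤ f p′ q′ ℚ.+ (dist p p′ ℚ.+ dist q q′)
    half p p′ q q′ = subst (f p q ℚ.≤_) (equivariant p′ q′ _)
      (mono (ℚₚ.≤-trans (≤+dist p p′) (ℚₚ.+-monoʳ-≤ p′ (≤+≤ˡ {dist p p′} (ℚₚ.0≤∣p∣ (q ℚ.- q′)))))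
            (ℚₚ.≤-trans (≤+dist q q′) (ℚₚ.+-monoʳ-≤ q′ (≤+≤ʳ {dist q q′} (ℚₚ.0≤∣p∣ (p ℚ.- p′))))))

  ⊔-lipschitz : Lipschitz₂ ℚ._⊔_
  ⊔-lipschitz = shift-mono₂ ℚ._⊔_ ℚₚ.⊔-mono-≤
    (λ p q e → sym (ℚₚ.mono-≤-distrib-⊔ {f = ℚ._+ e} (ℚₚ.+-monoˡ-≤ e) p q))

  ⊓-lipschitz : Lipschitz₂ ℚ._⊓_
  ⊓-lipschitz = shift-mono₂ ℚ._⊓_ ℚₚ.⊓-mono-≤
    (λ p q e → sym (ℚₚ.mono-≤-distrib-⊓ {f = ℚ._+ e} (ℚₚ.+-monoˡ-≤ e) p q))

  0<½* : ∀ {e} → 0ℚ ℚ.< e → 0ℚ ℚ.< e ℚ.* ½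
  0<½* {e} 0<e = subst (ℚ._< e ℚ.* ½) (ℚₚ.*-zeroˡ ½) (ℚₚ.*-monoˡ-<-pos ½ 0<e)

  half+half : ∀ e → e ℚ.* ½ ℚ.+ e ℚ.* ½ ≡ e
  half+half e = trans (sym (ℚₚ.*-distribˡ-+ e ½ ½)) (ℚₚ.*-identityʳ e)

  0<* : ∀ {p q} → 0ℚ ℚ.< p → 0ℚ ℚ.< q → 0ℚ ℚ.< p ℚ.* q
  0<* {p} {q} 0<p 0<q =
    subst (ℚ._< p ℚ.* q) (ℚₚ.*-zeroˡ q) (ℚₚ.*-monoˡ-<-pos q {{ℚ.positive 0<q}} 0<p)

  *-mono : ∀ {p p′ q q′} → 0ℚ ℚ.≤ q → 0ℚ ℚ.≤ p′ → p ℚ.≤ p′ → q ℚ.≤ q′ →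
           p ℚ.* q ℚ.≤ p′ ℚ.* q′
  *-mono {p′ = p′} {q = q} 0≤q 0≤p′ p≤p′ q≤q′ = ℚₚ.≤-trans
    (ℚₚ.*-monoʳ-≤-nonNeg q {{ℚ.nonNegative 0≤q}} p≤p′)
    (ℚₚ.*-monoˡ-≤-nonNeg p′ {{ℚ.nonNegative 0≤p′}} q≤q′)

  dist-* : ∀ p p′ q q′ →
    dist (p ℚ.* q) (p′ ℚ.* q′) ℚ.≤ ℚ.∣ p ∣ ℚ.* dist q q′ ℚ.+ ℚ.∣ q′ ∣ ℚ.* dist p p′
  dist-* p p′ q q′ = subst (dist (p ℚ.* q) (p′ ℚ.* q′) ℚ.≤_)
    (cong₂ ℚ._+_ (ℚₚ.∣p*q∣≡∣p∣*∣q∣ p _) (ℚₚ.∣p*q∣≡∣p∣*∣q∣ q′ _))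
    (subst (λ z → ℚ.∣ z ∣ ℚ.≤ ℚ.∣ p ℚ.* (q ℚ.- q′) ∣ ℚ.+ ℚ.∣ q′ ℚ.* (p ℚ.- p′) ∣)
      (lem p p′ q q′) (ℚₚ.∣p+q∣≤∣p∣+∣q∣ (p ℚ.* (q ℚ.- q′)) (q′ ℚ.* (p ℚ.- p′))))
    where
    open +-*-Solver
    lem : ∀ p p′ q q′ → p ℚ.* (q ℚ.- q′) ℚ.+ q′ ℚ.* (p ℚ.- p′) ≡ p ℚ.* q ℚ.- p′ ℚ.* q′
    lem = solve 4 (λ p p′ q q′ → p :* (q :- q′) :+ q′ :* (p :- p′) := p :* q :- p′ :* q′) refl

  *-close : ∀ p p′ q q′ b c d e → 0ℚ ℚ.≤ b → 0ℚ ℚ.≤ c → b ℚ.* d ℚ.+ c ℚ.* d ≡ e →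
    ℚ.∣ p ∣ ℚ.≤ b → ℚ.∣ q′ ∣ ℚ.≤ c → dist p p′ ℚ.≤ d → dist q q′ ℚ.≤ d →
    dist (p ℚ.* q) (p′ ℚ.* q′) ℚ.≤ e
  *-close p p′ q q′ b c d e 0≤b 0≤c bd+cd≡e ∣p∣≤b ∣q′∣≤c p~p′ q~q′ = begin
    dist (p ℚ.* q) (p′ ℚ.* q′)                          ≤⟨ dist-* p p′ q q′ ⟩
    ℚ.∣ p ∣ ℚ.* dist q q′ ℚ.+ ℚ.∣ q′ ∣ ℚ.* dist p p′    ≤⟨ ℚₚ.+-mono-≤ (*-mono (ℚₚ.0≤∣p∣ (q ℚ.- q′)) 0≤b ∣p∣≤b q~q′) (*-mono (ℚₚ.0≤∣p∣ (p ℚ.- p′)) 0≤c ∣q′∣≤c p~p′) ⟩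
    b ℚ.* d ℚ.+ c ℚ.* d                                 ≡⟨ bd+cd≡e ⟩
    e                                                   ∎
    where open ℚₚ.≤-Reasoning

  split : ∀ b c e → 0ℚ ℚ.< b → 0ℚ ℚ.< c → 0ℚ ℚ.< e →
          ∃[ d ] (0ℚ ℚ.< d × b ℚ.* d ℚ.+ c ℚ.* d ≡ e)
  split b c e 0<b 0<c 0<e = e ℚ.* i , 0<* 0<e 0<i , total
    where
    pos = ℚ.positive (ℚₚ.+-mono-< 0<b 0<c)
    nz  = ℚₚ.pos⇒nonZero (b ℚ.+ c) {{pos}}
    i : ℚ
    i = (ℚ.1/ (b ℚ.+ c)) {{nz}}
    0<i : 0ℚ ℚ.< i
    0<i = ℚₚ.positive⁻¹ i {{ℚₚ.1/pos⇒pos (b ℚ.+ c) {{pos}}}}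
    lem : ∀ b c e i → b ℚ.* (e ℚ.* i) ℚ.+ c ℚ.* (e ℚ.* i) ≡ e ℚ.* (i ℚ.* (b ℚ.+ c))
    lem = solve 4 (λ b c e i → b :* (e :* i) :+ c :* (e :* i) := e :* (i :* (b :+ c))) refl
      where open +-*-Solver
    total : b ℚ.* (e ℚ.* i) ℚ.+ c ℚ.* (e ℚ.* i) ≡ e
    total = trans (lem b c e i)
      (trans (cong (e ℚ.*_) (ℚₚ.*-inverseˡ (b ℚ.+ c) {{nz}})) (ℚₚ.*-identityʳ e))

------------------------------------------------------------------------
-- The real numbers: Cauchy sequences of rationals

record ℝ : Set where
  constructor mkℝ
  field
    seq    : ℕ → ℚ
    cauchy : ∀ e → 0ℚ ℚ.< e →
             ∃[ N ] (∀ m n → N ℕ.≤ m → N ℕ.≤ n → ℚ.∣ seq m ℚ.- seq n ∣ ℚ.≤ e)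

open ℝ public

infix 4 _≤_ _<_

_≤_ : ℝ → ℝ → Set
x ≤ y = ∀ e → 0ℚ ℚ.< e → ∃[ N ] (∀ n → N ℕ.≤ n → seq x n ℚ.≤ seq y n ℚ.+ e)

_<_ : ℝ → ℝ → Set
x < y = ∃[ e ] (0ℚ ℚ.< e × ∃[ N ] (∀ n → N ℕ.≤ n → seq x n ℚ.+ e ℚ.≤ seq y n))

fromℚ : ℚ → ℝ
fromℚ p = mkℝ (λ _ → p) λ e 0<e → 0 , λ _ _ _ _ →
  subst (ℚ._≤ e) (sym (cong ℚ.∣_∣ (ℚₚ.+-inverseʳ p))) (ℚₚ.<⇒≤ 0<e)

fromℕ : ℕ → ℝ
fromℕ n = fromℚ (ℤ.+ n ℚ./ 1)

0ℝ 1ℝ : ℝ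
0ℝ = fromℚ 0ℚ
1ℝ = fromℚ 1ℚ

private
  lift₁ : (f : ℚ → ℚ) → Lipschitz₁ f → ℝ → ℝ
  lift₁ f lip x = mkℝ (λ n → f (seq x n)) λ e 0<e →
    let N , close = cauchy x e 0<e
    in  N , λ m n N≤m N≤n → ℚₚ.≤-trans (lip _ _) (close m n N≤m N≤n)

  lift₂ : (f : ℚ → ℚ → ℚ) → Lipschitz₂ f → ℝ → ℝ → ℝ
  lift₂ f lip x y = mkℝ (λ n → f (seq x n) (seq y n)) λ e 0<e →
    let M , closeˣ = cauchy x (e ℚ.* ½) (0<½* 0<e)
        N , closeʸ = cauchy y (e ℚ.* ½) (0<½* 0<e)
    in  M ℕ.⊔ N , λ m n ≤m ≤n → ℚₚ.≤-trans (lip _ _ _ _)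
          (subst (_ ℚ.≤_) (half+half e) (ℚₚ.+-mono-≤
            (closeˣ m n (ℕₚ.m⊔n≤o⇒m≤o M N ≤m) (ℕₚ.m⊔n≤o⇒m≤o M N ≤n))
            (closeʸ m n (ℕₚ.m⊔n≤o⇒n≤o M N ≤m) (ℕₚ.m⊔n≤o⇒n≤o M N ≤n))))

  bound : (x : ℝ) → ∃[ b ] (0ℚ ℚ.< b × ∃[ N ] (∀ n → N ℕ.≤ n → ℚ.∣ seq x n ∣ ℚ.≤ b))
  bound x with cauchy x 1ℚ (ℚₚ.positive⁻¹ 1ℚ)
  ... | N , close = ℚ.∣ seq x N ∣ ℚ.+ 1ℚ
    , ℚₚ.+-mono-≤-< (ℚₚ.0≤∣p∣ (seq x N)) (ℚₚ.positive⁻¹ 1ℚ)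
    , N , λ n N≤n → ℚₚ.≤-trans (≤+dist ℚ.∣ seq x n ∣ ℚ.∣ seq x N ∣)
        (ℚₚ.+-monoʳ-≤ ℚ.∣ seq x N ∣
          (ℚₚ.≤-trans (abs-lipschitz (seq x n) (seq x N)) (close n N N≤n ℕₚ.≤-refl)))

infix  8 -_
infixl 7 _*_ _⊓_
infixl 6 _+_ _-_ _⊔_
infix  9 _⁻¹⟨_⟩
infixr 9 _^_

_+_ _⊔_ _⊓_ : ℝ → ℝ → ℝ
_+_ = lift₂ ℚ._+_ +-lipschitz
_⊔_ = lift₂ ℚ._⊔_ ⊔-lipschitz
_⊓_ = lift₂ ℚ._⊓_ ⊓-lipschitz

-_ : ℝ → ℝ
- x = lift₁ (λ p → ℚ.- p) neg-lipschitz x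

∣_∣ : ℝ → ℝ
∣_∣ = lift₁ ℚ.∣_∣ abs-lipschitz

_-_ : ℝ → ℝ → ℝ
x - y = x + (- y)

_*_ : ℝ → ℝ → ℝ
x * y = mkℝ (λ n → seq x n ℚ.* seq y n) λ e 0<e →
  let b , 0<b , K , ∣x∣≤b = bound x
      c , 0<c , L , ∣y∣≤c = bound y
      d , 0<d , bd+cd≡e   = split b c e 0<b 0<c 0<e
      M , closeˣ          = cauchy x d 0<d
      N , closeʸ          = cauchy y d 0<d
  in  (K ℕ.⊔ L) ℕ.⊔ (M ℕ.⊔ N) , λ m n ≤m ≤n →
        let ≤m₁ = ℕₚ.m⊔n≤o⇒m≤o (K ℕ.⊔ L) (M ℕ.⊔ N) ≤m
            ≤m₂ = ℕₚ.m⊔n≤o⇒n≤o (K ℕ.⊔ L) (M ℕ.⊔ N) ≤m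
            ≤n₁ = ℕₚ.m⊔n≤o⇒m≤o (K ℕ.⊔ L) (M ℕ.⊔ N) ≤n
            ≤n₂ = ℕₚ.m⊔n≤o⇒n≤o (K ℕ.⊔ L) (M ℕ.⊔ N) ≤n
        in  *-close (seq x m) (seq x n) (seq y m) (seq y n) b c d e
              (ℚₚ.<⇒≤ 0<b) (ℚₚ.<⇒≤ 0<c) bd+cd≡e
              (∣x∣≤b m (ℕₚ.m⊔n≤o⇒m≤o K L ≤m₁))
              (∣y∣≤c n (ℕₚ.m⊔n≤o⇒n≤o K L ≤n₁))
              (closeˣ m n (ℕₚ.m⊔n≤o⇒m≤o M N ≤m₂) (ℕₚ.m⊔n≤o⇒m≤o M N ≤n₂))
              (closeʸ m n (ℕₚ.m⊔n≤o⇒n≤o M N ≤m₂) (ℕₚ.m⊔n≤o⇒n≤o M N ≤n₂))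

_^_ : ℝ → ℕ → ℝ
x ^ zero  = 1ℝ
x ^ suc n = x * x ^ n

private
  module Truncated (d : ℚ) (0<d : 0ℚ ℚ.< d) where
    d≤ : ∀ p → d ℚ.≤ p ℚ.⊔ d
    d≤ p = ℚₚ.p≤q⊔p p d

    recip : ℚ → ℚ
    recip p = (ℚ.1/ (p ℚ.⊔ d)) {{ℚ.>-nonZero (ℚₚ.<-≤-trans 0<d (d≤ p))}}

    recip-inverse : ∀ p → (p ℚ.⊔ d) ℚ.* recip p ≡ 1ℚ
    recip-inverse p = ℚₚ.*-inverseʳ (p ℚ.⊔ d) {{ℚ.>-nonZero (ℚₚ.<-≤-trans 0<d (d≤ p))}}

    0≤recip : ∀ p → 0ℚ ℚ.≤ recip p
    0≤recip p = ℚₚ.<⇒≤ (ℚₚ.positive⁻¹ _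
      {{ℚₚ.1/pos⇒pos (p ℚ.⊔ d) {{ℚ.positive (ℚₚ.<-≤-trans 0<d (d≤ p))}}}})

    d*recip≤1 : ∀ p → d ℚ.* recip p ℚ.≤ 1ℚ
    d*recip≤1 p = subst (d ℚ.* recip p ℚ.≤_) (recip-inverse p)
      (ℚₚ.*-monoʳ-≤-nonNeg (recip p) {{ℚ.nonNegative (0≤recip p)}} (d≤ p))

    dist-⊔ : ∀ p q → dist (p ℚ.⊔ d) (q ℚ.⊔ d) ℚ.≤ dist p q
    dist-⊔ p q = ℚₚ.≤-trans (⊔-lipschitz p q d d)
      (ℚₚ.≤-reflexive (trans (cong (λ z → dist p q ℚ.+ ℚ.∣ z ∣) (ℚₚ.+-inverseʳ d))
                             (ℚₚ.+-identityʳ (dist p q))))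

    dist-recip : ∀ p q e → 0ℚ ℚ.≤ e → dist p q ℚ.≤ e ℚ.* (d ℚ.* d) →
                 dist (recip p) (recip q) ℚ.≤ e
    dist-recip p q e 0≤e p~q = begin
      dist i j                                          ≡⟨ cong ℚ.∣_∣ i-j ⟩
      ℚ.∣ (b ℚ.- a) ℚ.* (i ℚ.* j) ∣                     ≡⟨ ℚₚ.∣p*q∣≡∣p∣*∣q∣ (b ℚ.- a) (i ℚ.* j) ⟩
      dist b a ℚ.* ℚ.∣ i ℚ.* j ∣                        ≡⟨ cong₂ ℚ._*_ (dist-sym b a) (ℚₚ.0≤p⇒∣p∣≡p 0≤ij) ⟩
      dist a b ℚ.* (i ℚ.* j)                            ≤⟨ ℚₚ.*-monoʳ-≤-nonNeg (i ℚ.* j) (ℚₚ.≤-trans (dist-⊔ p q) p~q) ⟩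
      e ℚ.* (d ℚ.* d) ℚ.* (i ℚ.* j)                     ≡⟨ regroup e d i j ⟩
      e ℚ.* ((d ℚ.* i) ℚ.* (d ℚ.* j))                   ≤⟨ ℚₚ.*-monoˡ-≤-nonNeg e {{ℚ.nonNegative 0≤e}} didj≤1 ⟩
      e ℚ.* (1ℚ ℚ.* 1ℚ)                                 ≡⟨ ℚₚ.*-identityʳ e ⟩
      e                                                 ∎
      where
      open ℚₚ.≤-Reasoning
      a = p ℚ.⊔ d
      b = q ℚ.⊔ d
      i = recip p
      j = recip q
      0≤* : ∀ {s t} → 0ℚ ℚ.≤ s → 0ℚ ℚ.≤ t → 0ℚ ℚ.≤ s ℚ.* t
      0≤* {s} {t} 0≤s 0≤t = subst (ℚ._≤ s ℚ.* t) (ℚₚ.*-zeroˡ t)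
        (ℚₚ.*-monoʳ-≤-nonNeg t {{ℚ.nonNegative 0≤t}} 0≤s)
      0≤ij = 0≤* (0≤recip p) (0≤recip q)
      instance
        nonNeg-ij = ℚ.nonNegative 0≤ij
      0≤1 : 0ℚ ℚ.≤ 1ℚ
      0≤1 = ℚₚ.nonNegative⁻¹ 1ℚ
      didj≤1 : (d ℚ.* i) ℚ.* (d ℚ.* j) ℚ.≤ 1ℚ ℚ.* 1ℚ
      didj≤1 = *-mono (0≤* (ℚₚ.<⇒≤ 0<d) (0≤recip q)) 0≤1 (d*recip≤1 p) (d*recip≤1 q)
      regroup : ∀ e d i j →
        e ℚ.* (d ℚ.* d) ℚ.* (i ℚ.* j) ≡ e ℚ.* ((d ℚ.* i) ℚ.* (d ℚ.* j))
      regroup = solve 4 (λ e d i j →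
        e :* (d :* d) :* (i :* j) := e :* ((d :* i) :* (d :* j))) refl
        where open +-*-Solver
      expand : ∀ a b i j → (b ℚ.- a) ℚ.* (i ℚ.* j) ≡ (b ℚ.* j) ℚ.* i ℚ.- (a ℚ.* i) ℚ.* j
      expand = solve 4 (λ a b i j →
        (b :- a) :* (i :* j) := (b :* j) :* i :- (a :* i) :* j) refl
        where open +-*-Solver
      i-j : i ℚ.- j ≡ (b ℚ.- a) ℚ.* (i ℚ.* j)
      i-j = sym (trans (expand a b i j) (cong₂ ℚ._-_
        (trans (cong (ℚ._* i) (recip-inverse q)) (ℚₚ.*-identityˡ i))
        (trans (cong (ℚ._* j) (recip-inverse p)) (ℚₚ.*-identityˡ j))))

-- From some index on the terms of x are at least the witness d of 0 < x,
-- so replacing a term p by p ⊔ d before inverting changes only finitely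
-- many terms.
_⁻¹⟨_⟩ : (x : ℝ) → 0ℝ < x → ℝ
x ⁻¹⟨ d , 0<d , _ ⟩ = mkℝ (λ n → recip (seq x n)) λ e 0<e →
  let N , close = cauchy x (e ℚ.* (d ℚ.* d)) (0<* 0<e (0<* 0<d 0<d))
  in  N , λ m n N≤m N≤n → dist-recip (seq x m) (seq x n) e (ℚₚ.<⇒≤ 0<e) (close m n N≤m N≤n)
  where open Truncated d 0<d

-- Stated as a relation because x ↦ ⌈x⌉ is not a constructive function on ℝ.
IsCeiling : ℝ → ℕ → Set
IsCeiling x n = (fromℕ n - 1ℝ < x) × (x ≤ fromℕ n)

∑ : ∀ {n} → (Fin n → ℝ) → ℝ
∑ = Vector.foldr _+_ 0ℝ

‖_‖₁ : ∀ {n} → (Fin n → ℝ) → ℝ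
‖ x ‖₁ = ∑ (λ w → ∣ x w ∣)

------------------------------------------------------------------------
-- Median

-- Insertion sort with comparisons replaced by min and max, since the
-- order on ℝ is not decidable.
insert : ∀ {n} → ℝ → Vec ℝ n → Vec ℝ (suc n)
insert x Vec.[]       = x Vec.∷ Vec.[]
insert x (y Vec.∷ ys) = (x ⊓ y) Vec.∷ insert (x ⊔ y) ys

sort : ∀ {n} → Vec ℝ n → Vec ℝ n
sort Vec.[]       = Vec.[]
sort (x Vec.∷ xs) = insert x (sort xs)

-- The middle entry of the sorted vector (the lower one for even length).
median : ∀ {n} → Vec ℝ (suc n) → ℝ
median {n} xs = Vec.lookup (sort xs) (fromℕ< (s≤s (ℕₚ.⌊n/2⌋≤n n)))

------------------------------------------------------------------------
-- CountSketch with ℓ rows, r buckets per row and universe Fin U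

±1 : Sign → ℝ
±1 Sign.+ = 1ℝ
±1 Sign.- = - 1ℝ

record Outcome (ℓ U r : ℕ) : Set where
  constructor mkOutcome
  field
    hashes : Vec (Vec (Fin r) U) ℓ
    signs  : Vec (Vec Sign U) ℓ

  h : Fin ℓ → Fin U → Fin r
  h a w = Vec.lookup (Vec.lookup hashes a) w

  σ : Fin ℓ → Fin U → ℝ
  σ a w = ±1 (Vec.lookup (Vec.lookup signs a) w)

module _ {ℓ U r : ℕ} (x : Fin U → ℝ) (ω : Outcome ℓ U r) where
  open Outcome ω

  counter : Fin ℓ → Fin r → ℝ
  counter a b = ∑ (λ w → if does (h a w ≟ b) then σ a w * x w else 0ℝ)

  rowEstimate : Fin ℓ → Fin U → ℝ
  rowEstimate a u = σ a u * counter a (h a u)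

module _ {ℓ U r : ℕ} (x : Fin U → ℝ) (ω : Outcome (suc ℓ) U r) where

  estimate : Fin U → ℝ
  estimate u = median (Vec.tabulate (λ a → rowEstimate x ω a u))

  err : Fin U → ℝ
  err u = estimate u - x u

------------------------------------------------------------------------
-- Expectation

vectors : ∀ {A : Set} → List A → ∀ n → List (Vec A n)
vectors as zero    = Vec.[] ∷ []
vectors as (suc n) = cartesianProductWith Vec._∷_ as (vectors as n)

-- Every outcome is listed exactly once.
outcomes : ∀ ℓ U r → List (Outcome ℓ U r)
outcomes ℓ U r = cartesianProductWith mkOutcome
  (vectors (vectors (allFin r) U) ℓ)
  (vectors (vectors (Sign.+ ∷ Sign.- ∷ []) U) ℓ)

mean : List ℝ → ℝ
mean []         = 0ℝ
mean xs@(_ ∷ _) = fromℚ (ℤ.+ 1 ℚ./ length xs) * foldr _+_ 0ℝ xs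

-- All hash values and signs are independent and uniform exactly when the
-- outcome is uniform on the finite product space of all outcomes.
𝔼 : ∀ {ℓ U r} → (Outcome ℓ U r → ℝ) → ℝ
𝔼 {ℓ} {U} {r} f = mean (map f (outcomes ℓ U r))

{-# OPTIONS --safe #-}

-- Flipping the signs of u in all rows negates every Y_{a,u} and fixes every
-- Y_{a,v} in which u and v do not collide, so only outcomes with a colliding
-- row contribute to the expectation.  Since three of the five |Y_a| are at
-- least |median Y|, twice |median Y| is at most the sum of any four |Y_a|, and
-- |median Y| is at most the sum of any three.  The first bound, for both
-- errors, is used if exactly one row collides and gives 5 · 4 / r³; the second,
-- for err(u), with |err(v)| ≤ ‖x‖₁, is used if two rows collide and gives
-- 10 · 3 / r³.  The reals here are sequences of rationals with termwise
-- operations, so all of this is done for the rational vector of n-th terms.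
module Submission where

import Algebra.Properties.CommutativeSemigroup as CommutativeSemigroupProperties
import Algebra.Properties.Semiring.Sum as SemiringSum
open import Algebra.Bundles using (CommutativeMonoid; CommutativeRing)
open import Data.Bool.Base using (Bool; true; false; if_then_else_)
open import Data.Fin.Base using (Fin; zero; suc; punchIn; punchOut; fromℕ<)
open import Data.Fin.Properties as Finₚ using (_≟_; any?)
import Data.Integer.Base as ℤ
import Data.Integer.Properties as ℤₚ
open import Data.List.Base as List using (List; []; _∷_; allFin; cartesianProductWith)
import Data.List.Properties as Listₚ
open import Data.List.Relation.Binary.Permutation.Propositional as ↭
  using (_↭_; ↭-sym; ↭-trans; ↭-reflexive; ↭-refl)
open import Data.List.Relation.Binary.Permutation.Propositional.Properties
  using (All-resp-↭; ↭-reverse; map⁺)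
open import Data.List.Relation.Binary.Pointwise using (Pointwise-≡⇒≡)
open import Data.List.Relation.Unary.All as All using (All; []; _∷_)
open import Data.List.Relation.Unary.AllPairs as AllPairs using (AllPairs; []; _∷_)
import Data.List.Relation.Unary.AllPairs.Properties as AllPairsₚ
import Data.List.Relation.Unary.Linked.Properties as Linkedₚ
open import Data.List.Relation.Unary.Sorted.TotalOrder.Properties using (↗↭↗⇒≋)
open import Data.Nat.Base as ℕ using (ℕ; zero; suc; s≤s)
import Data.Nat.Properties as ℕₚ
open import Data.Product.Base using (_×_; _,_; ∃-syntax)
open import Data.Rational.Base as ℚ using (ℚ; 0ℚ; 1ℚ)
import Data.Rational.Properties as ℚₚ
open import Data.Rational.Solver using (module +-*-Solver)
import Data.Rational.Unnormalised.Base as ℚᵘ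
import Data.Rational.Unnormalised.Properties as ℚᵘₚ
open import Data.Sign.Base as Sign using (Sign; opposite)
open import Data.Sum.Base using (_⊎_; inj₁; inj₂)
open import Data.Vec.Base as Vec using (Vec; []; _∷_; toList; lookup; tabulate; insertAt; removeAt; updateAt)
import Data.Vec.Properties as Vecₚ
open import Function.Base using (_∘_)
open import Relation.Binary.Bundles using (DecTotalOrder)
open import Relation.Binary.PropositionalEquality
open import Relation.Nullary.Decidable using (Dec; does; yes; no; dec-true; dec-false; ¬?; _×-dec_)
open import Relation.Nullary.Negation using (¬_)

-- The rate 1/r³ needs three independent factors of order 1/r: one collision and one bucket mass for
-- each of the two errors, or two collisions and one mass. Colliding rows are left out of the bound
-- on the median precisely so that the masses that remain come from other rows and are independent
-- of the collisions. With one collision, the product of the two bounds also contains pairs of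
-- masses from the same row. They still cost 1/r², because once u and v are deleted from the
-- weights, the mass around v does not depend on the hash of u. Rows can be left out because the
-- |Y_a| are first capped at m = |median Y|: the capped sum is at least 3m, and each removed row
-- costs at most m. Absolute values may be taken only after the signs have been summed for fixed
-- hash values, otherwise the cancellation is lost. Sorting and the case distinctions on signs use
-- the total order of ℚ, which has no constructive counterpart on ℝ. Probabilities appear as totals
-- over lists with cleared denominators, so nothing is divided by r until the end.

module Rat where

  open import Data.Rational.Base
  open import Data.Rational.Properties hiding (_≟_)
  open import Defs using (vectors; Outcome; mkOutcome; outcomes)

  open SemiringSum (CommutativeRing.semiring +-*-commutativeRing) public using (sum; sum-cong-≗)
  open SemiringSum (CommutativeRing.semiring +-*-commutativeRing) using
    (sum-remove; sum-replicate-zero; ∑-distrib-+; *-distribˡ-sum; *-distribʳ-sum)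
  open CommutativeSemigroupProperties (CommutativeMonoid.commutativeSemigroup +-0-commutativeMonoid)
    using () renaming (x∙yz≈y∙xz to +-exchange)
  open CommutativeSemigroupProperties (CommutativeMonoid.commutativeSemigroup *-1-commutativeMonoid)
    using () renaming (x∙yz≈y∙xz to *-exchange)

  -- Order and finite sums of rationals

  0≤+ : ∀ {p q} → 0ℚ ≤ p → 0ℚ ≤ q → 0ℚ ≤ p + q
  0≤+ = +-mono-≤

  0≤* : ∀ {p q} → 0ℚ ≤ p → 0ℚ ≤ q → 0ℚ ≤ p * q
  0≤* {p} {q} 0≤p 0≤q =
    nonNegative⁻¹ (p * q) {{nonNeg*nonNeg⇒nonNeg p {{nonNegative 0≤p}} q {{nonNegative 0≤q}}}}

  *-monoˡ : ∀ {r p q} → 0ℚ ≤ r → p ≤ q → r * p ≤ r * q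
  *-monoˡ {r} 0≤r = *-monoˡ-≤-nonNeg r {{nonNegative 0≤r}}

  *-mono : ∀ {p q s t} → 0ℚ ≤ p → 0ℚ ≤ t → p ≤ q → s ≤ t → p * s ≤ q * t
  *-mono {p} {q} {s} {t} 0≤p 0≤t p≤q s≤t =
    ≤-trans (*-monoˡ 0≤p s≤t) (*-monoʳ-≤-nonNeg t {{nonNegative 0≤t}} p≤q)

  p≤∣p∣ : ∀ p → p ≤ ∣ p ∣
  p≤∣p∣ p with ≤-total 0ℚ p
  ... | inj₁ 0≤p = ≤-reflexive (sym (0≤p⇒∣p∣≡p 0≤p))
  ... | inj₂ p≤0 = ≤-trans p≤0 (0≤∣p∣ p)

  -p≤∣p∣ : ∀ p → - p ≤ ∣ p ∣
  -p≤∣p∣ p = subst (- p ≤_) (∣-p∣≡∣p∣ p) (p≤∣p∣ (- p))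

  ∣p∣≤ : ∀ {p e} → p ≤ e → - p ≤ e → ∣ p ∣ ≤ e
  ∣p∣≤ {p} {e} p≤e -p≤e with ∣p∣≡p∨∣p∣≡-p p
  ... | inj₁ eq = subst (_≤ e) (sym eq) p≤e
  ... | inj₂ eq = subst (_≤ e) (sym eq) -p≤e

  +-cancelʳ-≤ : ∀ r {p q} → p + r ≤ q + r → p ≤ q
  +-cancelʳ-≤ r {p} {q} p+r≤q+r = subst₂ _≤_ (cancel p r) (cancel q r) (+-monoˡ-≤ (- r) p+r≤q+r)
    where
    open +-*-Solver
    cancel : ∀ p r → p + r - r ≡ p
    cancel = solve 2 (λ p r → p :+ r :- r := p) refl

  sum-mono-≤ : ∀ {n} {f g : Fin n → ℚ} → (∀ i → f i ≤ g i) → sum f ≤ sum g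
  sum-mono-≤ {zero}  f≤g = ≤-refl
  sum-mono-≤ {suc n} f≤g = +-mono-≤ (f≤g zero) (sum-mono-≤ (f≤g ∘ suc))

  sum-0≤ : ∀ {n} {f : Fin n → ℚ} → (∀ i → 0ℚ ≤ f i) → 0ℚ ≤ sum f
  sum-0≤ {zero}  0≤f = ≤-refl
  sum-0≤ {suc n} 0≤f = 0≤+ (0≤f zero) (sum-0≤ (0≤f ∘ suc))

  ∣sum∣≤ : ∀ {n} (f : Fin n → ℚ) → ∣ sum f ∣ ≤ sum (∣_∣ ∘ f)
  ∣sum∣≤ {zero}  f = ≤-refl
  ∣sum∣≤ {suc n} f = ≤-trans (∣p+q∣≤∣p∣+∣q∣ (f zero) (sum (f ∘ suc)))
    (+-monoʳ-≤ ∣ f zero ∣ (∣sum∣≤ (f ∘ suc)))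

  -- The sorting median

  insert : ∀ {n} → ℚ → Vec ℚ n → Vec ℚ (suc n)
  insert x []       = x ∷ []
  insert x (y ∷ ys) = (x ⊓ y) ∷ insert (x ⊔ y) ys

  sort : ∀ {n} → Vec ℚ n → Vec ℚ n
  sort []       = []
  sort (x ∷ xs) = insert x (sort xs)

  median : ∀ {n} → Vec ℚ (suc n) → ℚ
  median {n} xs = lookup (sort xs) (fromℕ< (s≤s (ℕₚ.⌊n/2⌋≤n n)))

  ⊓∷⊔-↭ : ∀ x y (zs : List ℚ) → x ⊓ y ∷ x ⊔ y ∷ zs ↭ x ∷ y ∷ zs
  ⊓∷⊔-↭ x y zs with ≤-total x y
  ... | inj₁ x≤y rewrite p≤q⇒p⊓q≡p x≤y | p≤q⇒p⊔q≡q x≤y = ↭-refl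
  ... | inj₂ y≤x rewrite p≥q⇒p⊓q≡q y≤x | p≥q⇒p⊔q≡p y≤x = ↭.swap y x ↭-refl

  insert-↭ : ∀ {n} x (ys : Vec ℚ n) → toList (insert x ys) ↭ x ∷ toList ys
  insert-↭ x []       = ↭-refl
  insert-↭ x (y ∷ ys) = ↭-trans (↭.prep (x ⊓ y) (insert-↭ (x ⊔ y) ys)) (⊓∷⊔-↭ x y (toList ys))

  sort-↭ : ∀ {n} (xs : Vec ℚ n) → toList (sort xs) ↭ toList xs
  sort-↭ []       = ↭-refl
  sort-↭ (x ∷ xs) = ↭-trans (insert-↭ x (sort xs)) (↭.prep x (sort-↭ xs))

  insert-↗ : ∀ {n} x {ys : Vec ℚ n} → AllPairs _≤_ (toList ys) → AllPairs _≤_ (toList (insert x ys))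
  insert-↗ x {[]}     []            = [] ∷ []
  insert-↗ x {y ∷ ys} (y≤ys ∷ ys↗) =
    All-resp-↭ (↭-sym (insert-↭ (x ⊔ y) ys))
      (≤-trans (p⊓q≤p x y) (p≤p⊔q x y) ∷ All.map (≤-trans (p⊓q≤q x y)) y≤ys)
    ∷ insert-↗ (x ⊔ y) ys↗

  sort-↗ : ∀ {n} (xs : Vec ℚ n) → AllPairs _≤_ (toList (sort xs))
  sort-↗ []       = []
  sort-↗ (x ∷ xs) = insert-↗ x (sort-↗ xs)

  module _ {f : ℚ → ℚ} (mono : ∀ {p q} → p ≤ q → f p ≤ f q) where

    -- `⊓` and `⊔` commute with monotone maps, hence so does every step of the insertion.
    map-insert : ∀ {n} x (ys : Vec ℚ n) → Vec.map f (insert x ys) ≡ insert (f x) (Vec.map f ys)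
    map-insert x []       = refl
    map-insert x (y ∷ ys) = cong₂ _∷_ (mono-≤-distrib-⊓ mono x y)
      (trans (map-insert (x ⊔ y) ys) (cong (λ z → insert z _) (mono-≤-distrib-⊔ mono x y)))

    map-sort : ∀ {n} (xs : Vec ℚ n) → Vec.map f (sort xs) ≡ sort (Vec.map f xs)
    map-sort []       = refl
    map-sort (x ∷ xs) = trans (map-insert x (sort xs)) (cong (insert (f x)) (map-sort xs))

    map-median : ∀ {n} (xs : Vec ℚ (suc n)) → f (median xs) ≡ median (Vec.map f xs)
    map-median {n} xs = trans (sym (Vecₚ.lookup-map (fromℕ< (s≤s (ℕₚ.⌊n/2⌋≤n n))) f (sort xs)))
      (cong (λ ys → lookup ys (fromℕ< (s≤s (ℕₚ.⌊n/2⌋≤n n)))) (map-sort xs))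

  -- Translation is monotone. This turns the error of the median estimate into the median of the row
  -- errors.
  median-tabulate-shift : ∀ {n} (f : Fin (suc n) → ℚ) c →
                          median (tabulate f) - c ≡ median (tabulate λ i → f i - c)
  median-tabulate-shift f c = trans (map-median (+-monoˡ-≤ (- c)) (tabulate f))
    (cong median (sym (Vecₚ.tabulate-∘ (_- c) f)))

  -- Two sorted lists that are permutations of each other coincide. Negation reverses the order and
  -- `reverse` restores it, so the right-hand list is sorted too.
  sort-neg : ∀ {n} (xs : Vec ℚ n) →
    toList (sort (Vec.map -_ xs)) ≡ List.reverse (List.map -_ (toList (sort xs)))
  sort-neg xs = Pointwise-≡⇒≡ (↗↭↗⇒≋ ≤-totalOrder
    (Linkedₚ.AllPairs⇒Linked (sort-↗ (Vec.map -_ xs)))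
    (Linkedₚ.AllPairs⇒Linked (reverse-↗ (AllPairsₚ.map⁺ (AllPairs.map neg-antimono-≤ (sort-↗ xs)))))
    (↭.↭⇒↭ₛ perm))
    where
    ≤-totalOrder = DecTotalOrder.totalOrder ≤-decTotalOrder
    reverse-↗ : ∀ {ys} → AllPairs _≥_ ys → AllPairs _≤_ (List.reverse ys)
    reverse-↗ {[]}     []           = []
    reverse-↗ {y ∷ ys} (ys≤y ∷ ys↘) = subst (AllPairs _≤_) (sym (Listₚ.unfold-reverse y ys))
      (AllPairsₚ.++⁺ (reverse-↗ ys↘) ([] ∷ [])
        (All.map (_∷ []) (All-resp-↭ (↭-sym (↭-reverse ys)) ys≤y)))
    perm : toList (sort (Vec.map -_ xs)) ↭ List.reverse (List.map -_ (toList (sort xs)))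
    perm = ↭-trans (sort-↭ (Vec.map -_ xs)) (↭-trans
      (↭-reflexive (Vecₚ.toList-map -_ xs))
      (↭-trans (map⁺ -_ (↭-sym (sort-↭ xs))) (↭-sym (↭-reverse _))))

  sumₗ : List ℚ → ℚ
  sumₗ = List.foldr _+_ 0ℚ

  sumₗ-↭ : ∀ {xs ys} → xs ↭ ys → sumₗ xs ≡ sumₗ ys
  sumₗ-↭ ↭.refl                       = refl
  sumₗ-↭ (↭.prep x xs↭ys)             = cong (x +_) (sumₗ-↭ xs↭ys)
  sumₗ-↭ (↭.swap {ys = ys} x y xs↭ys) = trans (cong (λ s → x + (y + s)) (sumₗ-↭ xs↭ys))
    (+-exchange x y (sumₗ ys))
  sumₗ-↭ (↭.trans xs↭ys ys↭zs)        = trans (sumₗ-↭ xs↭ys) (sumₗ-↭ ys↭zs)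

  -- Three of the five entries lie on the far side of the middle one from 0.
  sorted₅-min : (s : Vec ℚ 5) → AllPairs _≤_ (toList s) → let m = ∣ lookup s (suc (suc zero)) ∣ in
                m + m + m ≤ sumₗ (List.map (λ y → ∣ y ∣ ⊓ m) (toList s))
  sorted₅-min (a ∷ b ∷ c ∷ d ∷ e ∷ [])
        ((a≤b ∷ a≤c ∷ a≤d ∷ a≤e ∷ []) ∷ (b≤c ∷ b≤d ∷ b≤e ∷ []) ∷ (c≤d ∷ c≤e ∷ []) ∷ (d≤e ∷ []) ∷ [] ∷ []) =
    ≤-trans (bound (≤-total 0ℚ c)) (≤-reflexive (assoc (φ a) (φ b) (φ c) (φ d) (φ e)))
    where
    open +-*-Solver
    φ : ℚ → ℚ
    φ y = ∣ y ∣ ⊓ ∣ c ∣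
    0≤φ : ∀ y → 0ℚ ≤ φ y
    0≤φ y = ⊓-glb (0≤∣p∣ y) (0≤∣p∣ c)
    assoc : ∀ a b c d e → (a + b) + c + (d + e) ≡ a + (b + (c + (d + (e + 0ℚ))))
    assoc = solve 5 (λ a b c d e → (a :+ b) :+ c :+ (d :+ e) := a :+ (b :+ (c :+ (d :+ (e :+ con 0ℚ))))) refl
    collectˡ : ∀ m → m + m + m + (0ℚ + 0ℚ) ≡ m + m + m
    collectˡ = solve 1 (λ m → m :+ m :+ m :+ (con 0ℚ :+ con 0ℚ) := m :+ m :+ m) refl
    collectʳ : ∀ m → 0ℚ + 0ℚ + m + (m + m) ≡ m + m + m
    collectʳ = solve 1 (λ m → con 0ℚ :+ con 0ℚ :+ m :+ (m :+ m) := m :+ m :+ m) refl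
    m≤φ : ∀ {y} → ∣ c ∣ ≤ ∣ y ∣ → ∣ c ∣ ≤ φ y
    m≤φ c≤y = ⊓-glb c≤y ≤-refl
    bound : 0ℚ ≤ c ⊎ c ≤ 0ℚ → ∣ c ∣ + ∣ c ∣ + ∣ c ∣ ≤ φ a + φ b + φ c + (φ d + φ e)
    bound (inj₁ 0≤c) = ≤-trans (≤-reflexive (sym (collectʳ ∣ c ∣)))
      (+-mono-≤ (+-mono-≤ (+-mono-≤ (0≤φ a) (0≤φ b)) (m≤φ ≤-refl)) (+-mono-≤ (above c≤d) (above c≤e)))
      where
      above : ∀ {y} → c ≤ y → ∣ c ∣ ≤ φ y
      above {y} c≤y = m≤φ (subst (_≤ ∣ y ∣) (sym (0≤p⇒∣p∣≡p 0≤c)) (≤-trans c≤y (p≤∣p∣ y)))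
    bound (inj₂ c≤0) = ≤-trans (≤-reflexive (sym (collectˡ ∣ c ∣)))
      (+-mono-≤ (+-mono-≤ (+-mono-≤ (below a≤c) (below b≤c)) (m≤φ ≤-refl)) (+-mono-≤ (0≤φ d) (0≤φ e)))
      where
      below : ∀ {y} → y ≤ c → ∣ c ∣ ≤ φ y
      below {y} y≤c = m≤φ (∣p∣≤ (≤-trans c≤0 (0≤∣p∣ y)) (≤-trans (neg-antimono-≤ y≤c) (-p≤∣p∣ y)))

  -- Reversing five entries fixes the middle one; the odd length is what makes the median an odd
  -- function.
  negated-middle : (s t : Vec ℚ 5) → toList s ≡ List.reverse (List.map -_ (toList t)) →
                   lookup s (suc (suc zero)) ≡ - lookup t (suc (suc zero))
  negated-middle (_ ∷ _ ∷ s ∷ _ ∷ _ ∷ []) (_ ∷ _ ∷ t ∷ _ ∷ _ ∷ []) refl = refl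

  All-middle : ∀ {P : ℚ → Set} (s : Vec ℚ 5) → All P (toList s) → P (lookup s (suc (suc zero)))
  All-middle (_ ∷ _ ∷ _ ∷ _ ∷ _ ∷ []) (_ ∷ _ ∷ pc ∷ _) = pc

  -- The median of five: symmetry and domination

  opaque

    -- Opaque, so that later arguments see only the facts of this block and not the nested minima
    -- and maxima of the sort.
    median₅ : (Fin 5 → ℚ) → ℚ
    median₅ f = median (tabulate f)

    median₅-tabulate : ∀ f → median₅ f ≡ median (tabulate f)
    median₅-tabulate f = refl

    median₅-cong : ∀ {f g} → (∀ a → f a ≡ g a) → median₅ f ≡ median₅ g
    median₅-cong f≗g = cong median (Vecₚ.tabulate-cong f≗g)

    median₅-neg : ∀ f → median₅ (λ a → - f a) ≡ - median₅ f
    median₅-neg f = negated-middle (sort (Vec.map -_ (tabulate f))) (sort (tabulate f)) (sort-neg (tabulate f))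

    -- The capped sum is invariant under permutation, so the bound passes from the sorted entries to
    -- the rows in their given order.
    median₅-min : ∀ f → let m = ∣ median₅ f ∣ in m + m + m ≤ sum (λ a → ∣ f a ∣ ⊓ m)
    median₅-min f = subst (m + m + m ≤_) (sumₗ-↭ (map⁺ (λ y → ∣ y ∣ ⊓ m) (sort-↭ (tabulate f))))
      (sorted₅-min (sort (tabulate f)) (sort-↗ (tabulate f)))
      where
      m : ℚ
      m = ∣ median₅ f ∣

    median₅-bound : ∀ f {X} → (∀ a → ∣ f a ∣ ≤ X) → ∣ median₅ f ∣ ≤ X
    median₅-bound f {X} f≤X = All-middle {λ y → ∣ y ∣ ≤ X} (sort (tabulate f))
      (All-resp-↭ (↭-sym (sort-↭ (tabulate f)))
        (f≤X zero ∷ f≤X (suc zero) ∷ f≤X (suc (suc zero)) ∷ f≤X (suc (suc (suc zero)))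
         ∷ f≤X (suc (suc (suc (suc zero)))) ∷ []))

  -- The cap limits the omitted entry to m, so it uses up at most one of the three copies of m. The
  -- other entries stay capped so that a second one can be removed in the same way.
  median₅-omit₁ : ∀ f a → let m = ∣ median₅ f ∣ in m + m ≤ sum (λ j → ∣ f (punchIn a j) ∣ ⊓ m)
  median₅-omit₁ f a = +-cancelʳ-≤ m (begin
    m + m + m                                               ≤⟨ median₅-min f ⟩
    sum (λ b → ∣ f b ∣ ⊓ m)                                 ≡⟨ sum-remove {i = a} (λ b → ∣ f b ∣ ⊓ m) ⟩
    ∣ f a ∣ ⊓ m + sum (λ j → ∣ f (punchIn a j) ∣ ⊓ m)       ≡⟨ +-comm (∣ f a ∣ ⊓ m) _ ⟩
    sum (λ j → ∣ f (punchIn a j) ∣ ⊓ m) + ∣ f a ∣ ⊓ m       ≤⟨ +-monoʳ-≤ (sum λ j → ∣ f (punchIn a j) ∣ ⊓ m) (p⊓q≤q ∣ f a ∣ m) ⟩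
    sum (λ j → ∣ f (punchIn a j) ∣ ⊓ m) + m                 ∎)
    where
    open ≤-Reasoning
    m = ∣ median₅ f ∣

  median₅-omit₂ : ∀ f a b → ∣ median₅ f ∣ ≤ sum (λ j → ∣ f (punchIn a (punchIn b j)) ∣)
  median₅-omit₂ f a b = +-cancelʳ-≤ m (begin
    m + m                                                   ≤⟨ median₅-omit₁ f a ⟩
    sum (λ j → g j ⊓ m)                                     ≡⟨ sum-remove {i = b} (λ j → g j ⊓ m) ⟩
    g b ⊓ m + sum (λ j → g (punchIn b j) ⊓ m)               ≡⟨ +-comm (g b ⊓ m) _ ⟩
    sum (λ j → g (punchIn b j) ⊓ m) + g b ⊓ m               ≤⟨ +-mono-≤ (sum-mono-≤ λ j → p⊓q≤p (g (punchIn b j)) m) (p⊓q≤q (g b) m) ⟩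
    sum (λ j → g (punchIn b j)) + m                         ∎)
    where
    open ≤-Reasoning
    m = ∣ median₅ f ∣
    g : Fin 4 → ℚ
    g j = ∣ f (punchIn a j) ∣

  -- Totals over finite lists

  total : ∀ {A : Set} → (A → ℚ) → List A → ℚ
  total f xs = sumₗ (List.map f xs)

  card : ∀ {A : Set} → List A → ℚ
  card = total (λ _ → 1ℚ)

  module _ {A : Set} where

    total-cong : ∀ {f g : A → ℚ} → (∀ x → f x ≡ g x) → ∀ xs → total f xs ≡ total g xs
    total-cong f≗g []       = refl
    total-cong f≗g (x ∷ xs) = cong₂ _+_ (f≗g x) (total-cong f≗g xs)

    total-mono-≤ : ∀ {f g : A → ℚ} → (∀ x → f x ≤ g x) → ∀ xs → total f xs ≤ total g xs
    total-mono-≤ f≤g []       = ≤-refl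
    total-mono-≤ f≤g (x ∷ xs) = +-mono-≤ (f≤g x) (total-mono-≤ f≤g xs)

    ∣total∣≤ : ∀ (f : A → ℚ) xs → ∣ total f xs ∣ ≤ total (∣_∣ ∘ f) xs
    ∣total∣≤ f []       = ≤-refl
    ∣total∣≤ f (x ∷ xs) = ≤-trans (∣p+q∣≤∣p∣+∣q∣ (f x) (total f xs)) (+-monoʳ-≤ ∣ f x ∣ (∣total∣≤ f xs))

    0≤card : ∀ (xs : List A) → 0ℚ ≤ card xs
    0≤card []       = ≤-refl
    0≤card (x ∷ xs) = 0≤+ (nonNegative⁻¹ 1ℚ) (0≤card xs)

    total-0 : ∀ (xs : List A) → total (λ _ → 0ℚ) xs ≡ 0ℚ
    total-0 []       = refl
    total-0 (x ∷ xs) = cong (0ℚ +_) (total-0 xs)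

    total-+ : ∀ (f g : A → ℚ) xs → total (λ x → f x + g x) xs ≡ total f xs + total g xs
    total-+ f g []       = refl
    total-+ f g (x ∷ xs) = trans (cong (f x + g x +_) (total-+ f g xs))
      (interchange (f x) (g x) (total f xs) (total g xs))
      where
      open +-*-Solver
      interchange : ∀ a b c d → a + b + (c + d) ≡ a + c + (b + d)
      interchange = solve 4 (λ a b c d → a :+ b :+ (c :+ d) := a :+ c :+ (b :+ d)) refl

    total-*ˡ : ∀ c (f : A → ℚ) xs → total (λ x → c * f x) xs ≡ c * total f xs
    total-*ˡ c f []       = sym (*-zeroʳ c)
    total-*ˡ c f (x ∷ xs) = trans (cong (c * f x +_) (total-*ˡ c f xs))
      (sym (*-distribˡ-+ c (f x) (total f xs)))

    total-*ʳ : ∀ c (f : A → ℚ) xs → total (λ x → f x * c) xs ≡ total f xs * c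
    total-*ʳ c f xs = trans (total-cong (λ x → *-comm (f x) c) xs)
      (trans (total-*ˡ c f xs) (*-comm c (total f xs)))

    total-const : ∀ c (xs : List A) → total (λ _ → c) xs ≡ card xs * c
    total-const c xs = trans (total-cong (λ _ → sym (*-identityˡ c)) xs) (total-*ʳ c (λ _ → 1ℚ) xs)

    total-sum : ∀ {n} (f : Fin n → A → ℚ) xs →
                total (λ x → sum (λ i → f i x)) xs ≡ sum (λ i → total (f i) xs)
    total-sum {zero}  f xs = total-0 xs
    total-sum {suc n} f xs = trans (total-+ (f zero) (λ x → sum (λ i → f (suc i) x)) xs)
      (cong (total (f zero) xs +_) (total-sum (f ∘ suc) xs))

    total-tabulate : ∀ (f : A → ℚ) {n} (g : Fin n → A) → total f (List.tabulate g) ≡ sum (f ∘ g)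
    total-tabulate f {zero}  g = refl
    total-tabulate f {suc n} g = cong (f (g zero) +_) (total-tabulate f (g ∘ suc))

    total-++ : ∀ (f : A → ℚ) xs ys → total f (xs List.++ ys) ≡ total f xs + total f ys
    total-++ f []       ys = sym (+-identityˡ (total f ys))
    total-++ f (x ∷ xs) ys = trans (cong (f x +_) (total-++ f xs ys))
      (sym (+-assoc (f x) (total f xs) (total f ys)))

  module _ {A B : Set} where

    total-map : ∀ (f : B → ℚ) (g : A → B) xs → total f (List.map g xs) ≡ total (f ∘ g) xs
    total-map f g []       = refl
    total-map f g (x ∷ xs) = cong (f (g x) +_) (total-map f g xs)

    total-comm : ∀ (f : A → B → ℚ) xs ys →
                 total (λ x → total (f x) ys) xs ≡ total (λ y → total (λ x → f x y) xs) ys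
    total-comm f []       ys = sym (total-0 ys)
    total-comm f (x ∷ xs) ys = trans (cong (total (f x) ys +_) (total-comm f xs ys))
      (sym (total-+ (f x) (λ y → total (λ x → f x y) xs) ys))

  total-cartesianProductWith : ∀ {A B C : Set} (f : C → ℚ) (_∙_ : A → B → C) xs ys →
    total f (cartesianProductWith _∙_ xs ys) ≡ total (λ x → total (λ y → f (x ∙ y)) ys) xs
  total-cartesianProductWith f _∙_ []       ys = refl
  total-cartesianProductWith f _∙_ (x ∷ xs) ys =
    trans (total-++ f (List.map (x ∙_) ys) (cartesianProductWith _∙_ xs ys))
      (cong₂ _+_ (total-map f (x ∙_) ys) (total-cartesianProductWith f _∙_ xs ys))

  -- Totals over lists of vectors: independence of coordinates

  module _ {A : Set} (as : List A) where

    -- Vectors are enumerated head first; exchanging sums moves any chosen coordinate into the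
    -- innermost sum, which puts all coordinates on the same footing.
    total-insertAt : ∀ {n} (i : Fin (suc n)) (f : Vec A (suc n) → ℚ) →
      total f (vectors as (suc n)) ≡ total (λ v → total (λ a → f (insertAt v i a)) as) (vectors as n)
    total-insertAt {n} zero f = trans (total-cartesianProductWith f _∷_ as (vectors as n))
      (total-comm (λ a v → f (a ∷ v)) as (vectors as n))
    total-insertAt {suc n} (suc i) f = begin
      total f (vectors as (suc (suc n)))
        ≡⟨ total-cartesianProductWith f _∷_ as (vectors as (suc n)) ⟩
      total (λ a → total (λ v → f (a ∷ v)) (vectors as (suc n))) as
        ≡⟨ total-cong (λ a → total-insertAt i (λ v → f (a ∷ v))) as ⟩
      total (λ a → total (λ v → total (λ b → f (a ∷ insertAt v i b)) as) (vectors as n)) as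
        ≡⟨ total-cartesianProductWith (λ v → total (λ b → f (insertAt v (suc i) b)) as) _∷_ as (vectors as n) ⟨
      total (λ v → total (λ b → f (insertAt v (suc i) b)) as) (vectors as (suc n))
        ∎
      where open ≡-Reasoning

    -- Independence of one coordinate from the rest, as a factorisation of totals. Every later
    -- product of quantities from different rows is evaluated through it.
    total-removeAt : ∀ {n} (i : Fin (suc n)) (f : A → ℚ) (g : Vec A n → ℚ) →
      total (λ v → f (lookup v i) * g (removeAt v i)) (vectors as (suc n))
        ≡ total f as * total g (vectors as n)
    total-removeAt {n} i f g = begin
      total (λ v → f (lookup v i) * g (removeAt v i)) (vectors as (suc n))
        ≡⟨ total-insertAt i _ ⟩
      total (λ v → total (λ a → f (lookup (insertAt v i a) i) * g (removeAt (insertAt v i a) i)) as) (vectors as n)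
        ≡⟨ total-cong (λ v → total-cong (λ a → cong₂ (λ b w → f b * g w)
             (Vecₚ.insertAt-lookup v i a) (Vecₚ.removeAt-insertAt v i a)) as) (vectors as n) ⟩
      total (λ v → total (λ a → f a * g v) as) (vectors as n)
        ≡⟨ total-cong (λ v → total-*ʳ (g v) f as) (vectors as n) ⟩
      total (λ v → total f as * g v) (vectors as n)
        ≡⟨ total-*ˡ (total f as) g (vectors as n) ⟩
      total f as * total g (vectors as n)
        ∎
      where open ≡-Reasoning

    total-sum-removeAt : ∀ {n} (f : A → ℚ) (g : Vec A n → ℚ) →
      total (λ v → sum (λ i → f (lookup v i) * g (removeAt v i))) (vectors as (suc n))
        ≡ sum {suc n} (λ _ → total f as * total g (vectors as n))
    total-sum-removeAt {n} f g =
      trans (total-sum (λ i v → f (lookup v i) * g (removeAt v i)) (vectors as (suc n)))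
        (sum-cong-≗ λ i → total-removeAt i f g)

    card-vectors : ∀ n → card (vectors as (suc n)) ≡ card as * card (vectors as n)
    card-vectors n = total-removeAt {n} zero (λ _ → 1ℚ) (λ _ → 1ℚ)

  entries : ∀ {A : Set} {n} → (A → ℚ) → Vec A n → ℚ
  entries f v = sum (λ i → f (lookup v i))

  lookup-removeAt : ∀ {A : Set} {n} (v : Vec A (suc n)) i j →
                    lookup (removeAt v i) j ≡ lookup v (punchIn i j)
  lookup-removeAt (x ∷ v)     zero    j       = refl
  lookup-removeAt (x ∷ y ∷ v) (suc i) zero    = refl
  lookup-removeAt (x ∷ y ∷ v) (suc i) (suc j) = lookup-removeAt (y ∷ v) i j

  entries-removeAt : ∀ {A : Set} {n} (f : A → ℚ) (v : Vec A (suc n)) i →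
                     entries f v ≡ f (lookup v i) + entries f (removeAt v i)
  entries-removeAt f v i = trans (sum-remove {i = i} (λ j → f (lookup v j)))
    (cong (f (lookup v i) +_) (sum-cong-≗ λ j → cong f (sym (lookup-removeAt v i j))))

  module _ {A : Set} (as : List A) where

    total-entries : ∀ n (f : A → ℚ) →
      total (entries f) (vectors as (suc n)) ≡ sum {suc n} (λ _ → total f as * card (vectors as n))
    total-entries n f = trans
      (total-cong (λ v → sum-cong-≗ λ i → sym (*-identityʳ (f (lookup v i)))) (vectors as (suc n)))
      (total-sum-removeAt as {n} f (λ _ → 1ℚ))

    -- The product of the two sums splits into its diagonal, where both factors read the same
    -- coordinate, and the remainder, which factors by independence.
    total-entries² : ∀ n (f g : A → ℚ) →
      total (λ v → entries f v * entries g v) (vectors as (suc n))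
        ≡ sum {suc n} (λ _ → total (λ a → f a * g a) as * card (vectors as n))
        + sum {suc n} (λ _ → total f as * total (entries g) (vectors as n))
    total-entries² n f g = begin
      total (λ v → entries f v * entries g v) V
        ≡⟨ total-cong split V ⟩
      total (λ v → sum (λ i → f (lookup v i) * g (lookup v i) * 1ℚ)
                 + sum (λ i → f (lookup v i) * entries g (removeAt v i))) V
        ≡⟨ total-+ (λ v → sum (λ i → f (lookup v i) * g (lookup v i) * 1ℚ))
                   (λ v → sum (λ i → f (lookup v i) * entries g (removeAt v i))) V ⟩
      total (λ v → sum (λ i → f (lookup v i) * g (lookup v i) * 1ℚ)) V
        + total (λ v → sum (λ i → f (lookup v i) * entries g (removeAt v i))) V
        ≡⟨ cong₂ _+_ (total-sum-removeAt as (λ a → f a * g a) (λ _ → 1ℚ)) (total-sum-removeAt as f (entries g)) ⟩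
      _ ∎
      where
      open ≡-Reasoning
      V = vectors as (suc n)
      split : ∀ v → entries f v * entries g v ≡
        sum (λ i → f (lookup v i) * g (lookup v i) * 1ℚ) + sum (λ i → f (lookup v i) * entries g (removeAt v i))
      split v = begin
        entries f v * entries g v
          ≡⟨ *-distribʳ-sum (entries g v) (λ i → f (lookup v i)) ⟩
        sum (λ i → f (lookup v i) * entries g v)
          ≡⟨ sum-cong-≗ (λ i → trans (cong (f (lookup v i) *_) (entries-removeAt g v i))
               (expand (f (lookup v i)) (g (lookup v i)) (entries g (removeAt v i)))) ⟩
        sum (λ i → f (lookup v i) * g (lookup v i) * 1ℚ + f (lookup v i) * entries g (removeAt v i))
          ≡⟨ ∑-distrib-+ (λ i → f (lookup v i) * g (lookup v i) * 1ℚ) (λ i → f (lookup v i) * entries g (removeAt v i)) ⟩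
        sum (λ i → f (lookup v i) * g (lookup v i) * 1ℚ) + sum (λ i → f (lookup v i) * entries g (removeAt v i)) ∎
        where
        open +-*-Solver using (solve; _:+_; _:*_; _:=_; con)
        expand : ∀ a b c → a * (b + c) ≡ a * b * 1ℚ + a * c
        expand = solve 3 (λ a b c → a :* (b :+ c) := a :* b :* con 1ℚ :+ a :* c) refl

  -- Collisions in a row

  𝟙 : Bool → ℚ
  𝟙 b = if b then 1ℚ else 0ℚ

  0≤𝟙 : ∀ b → 0ℚ ≤ 𝟙 b
  0≤𝟙 true  = nonNegative⁻¹ 1ℚ
  0≤𝟙 false = ≤-refl

  sum-𝟙 : ∀ {r} (β : Fin r) (g : Fin r → ℚ) → sum (λ b → 𝟙 (does (β ≟ b)) * g b) ≡ g β
  sum-𝟙 {suc r} zero g = trans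
    (cong₂ _+_ (*-identityˡ (g zero))
      (trans (sum-cong-≗ λ b → *-zeroˡ (g (suc b))) (sum-replicate-zero r)))
    (+-identityʳ (g zero))
  sum-𝟙 {suc r} (suc β) g = trans (cong₂ _+_ (*-zeroˡ (g zero)) (sum-𝟙 β (g ∘ suc))) (+-identityˡ (g (suc β)))

  module _ {r U : ℕ} where

    hit : Vec (Fin r) U → Fin U → Fin U → ℚ
    hit h w u = 𝟙 (does (lookup h w ≟ lookup h u))

    -- The z-weight of the bucket of `u`, counting `u` itself; the lemmas on totals take z to vanish
    -- at `u`, so that only other elements contribute.
    mass : Fin U → (Fin U → ℚ) → Vec (Fin r) U → ℚ
    mass u z h = sum (λ w → hit h w u * z w)

    -- Pointwise form of independence from the hash value of `u`, the condition under which that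
    -- value may be resampled.
    Ignores : Fin U → (Vec (Fin r) U → ℚ) → Set
    Ignores u g = ∀ h h′ → (∀ w → w ≢ u → lookup h w ≡ lookup h′ w) → g h ≡ g h′

    -- The bucket inspected is that of another element, so the hash of `u` could enter only through
    -- the summand at `u`, which has weight 0.
    mass-ignores : ∀ {u v} z → v ≢ u → z u ≡ 0ℚ → Ignores u (mass v z)
    mass-ignores {u} {v} z v≢u zu≡0 h h′ h≗h′ = sum-cong-≗ λ w → same w (w ≟ u)
      where
      same : ∀ w → _ → hit h w v * z w ≡ hit h′ w v * z w
      same w (yes refl) rewrite zu≡0 = trans (*-zeroʳ (hit h u v)) (sym (*-zeroʳ (hit h′ u v)))
      same w (no w≢u)   = cong₂ (λ a b → 𝟙 (does (a ≟ b)) * z w) (h≗h′ w w≢u) (h≗h′ v v≢u)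

    0≤mass : ∀ u {z} → (∀ w → 0ℚ ≤ z w) → ∀ h → 0ℚ ≤ mass u z h
    0≤mass u 0≤z h = sum-0≤ λ w → 0≤* (0≤𝟙 (does (lookup h w ≟ lookup h u))) (0≤z w)

  -- Given the other hash values, h u is uniform.
  resample : ∀ {r U} {u w : Fin U} → u ≢ w → ∀ g → Ignores {r} u g →
    card (allFin r) * total (λ h → hit h w u * g h) (vectors (allFin r) U)
      ≡ total g (vectors (allFin r) U)
  resample {r} {suc U} {u} {w} u≢w g ign = begin
    card F * total (λ h → hit h w u * g h) (vectors F (suc U))
      ≡⟨ cong (card F *_) (total-insertAt F u _) ⟩
    card F * total (λ h → total (λ b → hit (ins h b) w u * g (ins h b)) F) (vectors F U)
      ≡⟨ cong (card F *_) (total-cong pick (vectors F U)) ⟩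
    card F * total (λ h → g (ins h (lookup h j))) (vectors F U)
      ≡⟨ total-*ˡ (card F) (λ h → g (ins h (lookup h j))) (vectors F U) ⟨
    total (λ h → card F * g (ins h (lookup h j))) (vectors F U)
      -- Since `g` does not see the hash of `u`, the colliding value may be replaced by each b in
      -- turn; `card F` counts these values.
      ≡⟨ total-cong (λ h → trans (sym (total-const (g (ins h (lookup h j))) F))
           (total-cong (λ b → ign _ _ (agree h (lookup h j) b)) F)) (vectors F U) ⟩
    total (λ h → total (λ b → g (ins h b)) F) (vectors F U)
      ≡⟨ total-insertAt F u g ⟨
    total g (vectors F (suc U)) ∎
    where
    open ≡-Reasoning
    F = allFin r
    j = punchOut u≢w
    ins : Vec (Fin r) U → Fin r → Vec (Fin r) (suc U)
    ins h b = insertAt h u b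
    lookup-ins : ∀ h b {w′} (u≢w′ : u ≢ w′) → lookup (ins h b) w′ ≡ lookup h (punchOut u≢w′)
    lookup-ins h b u≢w′ = trans (cong (lookup (ins h b)) (sym (Finₚ.punchIn-punchOut u≢w′)))
      (Vecₚ.insertAt-punchIn h u b (punchOut u≢w′))
    agree : ∀ h b c w′ → w′ ≢ u → lookup (ins h b) w′ ≡ lookup (ins h c) w′
    agree h b c w′ w′≢u = trans (lookup-ins h b (w′≢u ∘ sym)) (sym (lookup-ins h c (w′≢u ∘ sym)))
    pick : ∀ h → total (λ b → hit (ins h b) w u * g (ins h b)) F ≡ g (ins h (lookup h j))
    pick h = trans (total-tabulate (λ b → hit (ins h b) w u * g (ins h b)) (λ b → b)) (trans
      (sum-cong-≗ λ b → cong₂ (λ x y → 𝟙 (does (x ≟ y)) * g (ins h b))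
        (lookup-ins h b u≢w) (Vecₚ.insertAt-lookup h u b))
      (sum-𝟙 (lookup h j) (λ b → g (ins h b))))

  -- Linearity over w, with `resample` for each w other than `u`; the summand at `u` has weight 0.
  -- The extra factor `g` makes room for a second mass in the same row.
  total-mass : ∀ {r U} (u : Fin U) z → z u ≡ 0ℚ → ∀ g → Ignores {r} u g →
    card (allFin r) * total (λ h → mass u z h * g h) (vectors (allFin r) U)
      ≡ sum z * total g (vectors (allFin r) U)
  total-mass {r} {U} u z zu≡0 g ign = begin
    R * total (λ h → mass u z h * g h) V
      ≡⟨ cong (R *_) (total-cong (λ h → *-distribʳ-sum (g h) (λ w → hit h w u * z w)) V) ⟩
    R * total (λ h → sum (λ w → hit h w u * z w * g h)) V
      ≡⟨ cong (R *_) (total-sum (λ w h → hit h w u * z w * g h) V) ⟩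
    R * sum (λ w → total (λ h → hit h w u * z w * g h) V)
      ≡⟨ *-distribˡ-sum R (λ w → total (λ h → hit h w u * z w * g h) V) ⟩
    sum (λ w → R * total (λ h → hit h w u * z w * g h) V)
      ≡⟨ sum-cong-≗ (λ w → summand w (u ≟ w)) ⟩
    sum (λ w → z w * total g V)
      ≡⟨ *-distribʳ-sum (total g V) z ⟨
    sum z * total g V ∎
    where
    open ≡-Reasoning
    R = card (allFin r)
    V = vectors (allFin r) U
    open +-*-Solver using (solve; _:+_; _:*_; _:=_; con)
    pull : ∀ w → R * total (λ h → hit h w u * z w * g h) V ≡ z w * (R * total (λ h → hit h w u * g h) V)
    pull w = trans (cong (R *_) (trans (total-cong (λ h → rearrange (hit h w u) (z w) (g h)) V)
        (total-*ˡ (z w) (λ h → hit h w u * g h) V)))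
      (*-exchange R (z w) _)
      where
      rearrange : ∀ a b c → a * b * c ≡ b * (a * c)
      rearrange = solve 3 (λ a b c → a :* b :* c := b :* (a :* c)) refl
    summand : ∀ w → _ → R * total (λ h → hit h w u * z w * g h) V ≡ z w * total g V
    summand w (no u≢w)   = trans (pull w) (cong (z w *_) (resample u≢w g ign))
    summand w (yes refl) = trans (pull u) (vanish (R * total (λ h → hit h u u * g h) V) (total g V))
      where
      vanish : ∀ a b → z u * a ≡ z u * b
      vanish a b rewrite zu≡0 = trans (*-zeroˡ a) (sym (*-zeroˡ b))

  -- Splitting single entries off a sum

  module _ {U : ℕ} where

    off : Fin U → (Fin U → ℚ) → Fin U → ℚ
    off u z w = if does (w ≟ u) then 0ℚ else z w

    off-self : ∀ u z → off u z u ≡ 0ℚ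
    off-self u z rewrite dec-true (u ≟ u) refl = refl

    off-other : ∀ {u w} z → w ≢ u → off u z w ≡ z w
    off-other {u} {w} z w≢u rewrite dec-false (w ≟ u) w≢u = refl

    0≤off : ∀ u {z} → (∀ w → 0ℚ ≤ z w) → ∀ w → 0ℚ ≤ off u z w
    0≤off u 0≤z w with does (w ≟ u)
    ... | true  = ≤-refl
    ... | false = 0≤z w

    off≤ : ∀ u {z} → (∀ w → 0ℚ ≤ z w) → ∀ w → off u z w ≤ z w
    off≤ u 0≤z w with does (w ≟ u)
    ... | true  = 0≤z w
    ... | false = ≤-refl

  sum-off : ∀ {U} (u : Fin U) z → sum z ≡ z u + sum (off u z)
  sum-off {suc U} zero    z = cong (z zero +_) (sym (+-identityˡ (sum (z ∘ suc))))
  sum-off {suc U} (suc u) z = trans (cong (z zero +_) (sum-off u (z ∘ suc)))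
    (+-exchange (z zero) (z (suc u)) (sum (off u (z ∘ suc))))

  sum-≥-pair : ∀ {n} {f : Fin n → ℚ} → (∀ i → 0ℚ ≤ f i) → ∀ {i j} → i ≢ j → f i + f j ≤ sum f
  sum-≥-pair {f = f} 0≤f {i} {j} i≢j = ≤-trans (+-monoʳ-≤ (f i) fj≤) (≤-reflexive (sym (sum-off i f)))
    where
    0≤off-f : ∀ k → 0ℚ ≤ off i f k
    0≤off-f = 0≤off i 0≤f
    fj≤ : f j ≤ sum (off i f)
    fj≤ = begin
      f j                              ≡⟨ off-other f (i≢j ∘ sym) ⟨
      off i f j                        ≡⟨ +-identityʳ (off i f j) ⟨
      off i f j + 0ℚ                   ≤⟨ +-monoʳ-≤ (off i f j) (sum-0≤ (0≤off j 0≤off-f)) ⟩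
      off i f j + sum (off j (off i f)) ≡⟨ sum-off j (off i f) ⟨
      sum (off i f)                    ∎
      where open ≤-Reasoning

  sum-≥-entry : ∀ {n} {f : Fin n → ℚ} → (∀ i → 0ℚ ≤ f i) → ∀ i → f i ≤ sum f
  sum-≥-entry {f = f} 0≤f i = begin
    f i                 ≡⟨ +-identityʳ (f i) ⟨
    f i + 0ℚ            ≤⟨ +-monoʳ-≤ (f i) (sum-0≤ (0≤off i 0≤f)) ⟩
    f i + sum (off i f) ≡⟨ sum-off i f ⟨
    sum f               ∎
    where open ≤-Reasoning

  -- The error of a single row

  sgn : Sign → ℚ
  sgn Sign.+ = 1ℚ
  sgn Sign.- = - 1ℚ

  sgn-opposite : ∀ s → sgn (opposite s) ≡ - sgn s
  sgn-opposite Sign.+ = refl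
  sgn-opposite Sign.- = refl

  sgn² : ∀ s p → sgn s * (sgn s * p) ≡ p
  sgn² Sign.+ p = trans (*-identityˡ (1ℚ * p)) (*-identityˡ p)
  sgn² Sign.- p = solve 1 (λ p → con (- 1ℚ) :* (con (- 1ℚ) :* p) := p) refl p
    where open +-*-Solver

  ∣sgn*∣ : ∀ s p → ∣ sgn s * p ∣ ≡ ∣ p ∣
  ∣sgn*∣ s p = trans (∣p*q∣≡∣p∣*∣q∣ (sgn s) p) (trans (cong (_* ∣ p ∣) (unit s)) (*-identityˡ ∣ p ∣))
    where
    unit : ∀ s → ∣ sgn s ∣ ≡ 1ℚ
    unit Sign.+ = refl
    unit Sign.- = refl

  module _ {r U : ℕ} where

    mass-cong : ∀ (h : Vec (Fin r) U) u {z z′} → (∀ w → lookup h w ≡ lookup h u → z w ≡ z′ w) →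
                mass u z h ≡ mass u z′ h
    mass-cong h u {z} {z′} z≗z′ = sum-cong-≗ same
      where
      same : ∀ w → hit h w u * z w ≡ hit h w u * z′ w
      same w with lookup h w ≟ lookup h u
      ... | yes eq = cong (1ℚ *_) (z≗z′ w eq)
      ... | no  _  = trans (*-zeroˡ (z w)) (sym (*-zeroˡ (z′ w)))

    module _ (h : Vec (Fin r) U) (s : Vec Sign U) (y : Fin U → ℚ) where

      signed : Fin U → ℚ
      signed w = sgn (lookup s w) * y w

      rowEstimate : Fin U → ℚ
      rowEstimate u = sgn (lookup s u) *
        sum (λ w → if does (lookup h w ≟ lookup h u) then signed w else 0ℚ)

      -- Y_{a,u} for a single row a, with the sign of u taken out of the sum.
      noise : Fin U → ℚ
      noise u = sgn (lookup s u) * mass u (off u signed) h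

    -- The element's own summand carries a squared sign, so it equals the true value and the
    -- subtraction cancels it.
    rowEstimate-error : ∀ h s y u → rowEstimate h s y u - y u ≡ noise h s y u
    rowEstimate-error h s y u = begin
      sgn (lookup s u) * sum (λ w → if does (lookup h w ≟ lookup h u) then signed h s y w else 0ℚ) - y u
        ≡⟨ cong (λ t → σ * t - y u) (trans (sum-off u _) (cong₂ _+_ self (sum-cong-≗ rest))) ⟩
      σ * (σ * y u + M) - y u
        ≡⟨ expand σ (y u) M ⟩
      (σ * (σ * y u) - y u) + σ * M
        ≡⟨ cong (λ t → (t - y u) + σ * M) (sgn² (lookup s u) (y u)) ⟩
      (y u - y u) + σ * M
        ≡⟨ trans (cong (_+ σ * M) (+-inverseʳ (y u))) (+-identityˡ (σ * M)) ⟩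
      σ * M ∎
      where
      open ≡-Reasoning
      open +-*-Solver using (solve; _:+_; _:*_; _:-_; _:=_)
      σ = sgn (lookup s u)
      M = mass u (off u (signed h s y)) h
      self : (if does (lookup h u ≟ lookup h u) then signed h s y u else 0ℚ) ≡ σ * y u
      self rewrite dec-true (lookup h u ≟ lookup h u) refl = refl
      rest : ∀ w → off u (λ w → if does (lookup h w ≟ lookup h u) then signed h s y w else 0ℚ) w
                 ≡ hit h w u * off u (signed h s y) w
      rest w with does (w ≟ u) | does (lookup h w ≟ lookup h u)
      ... | true  | b     = sym (*-zeroʳ (𝟙 b))
      ... | false | true  = sym (*-identityˡ (signed h s y w))
      ... | false | false = sym (*-zeroˡ (signed h s y w))
      expand : ∀ σ y M → σ * (σ * y + M) - y ≡ (σ * (σ * y) - y) + σ * M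
      expand = solve 3 (λ σ y M → σ :* (σ :* y :+ M) :- y := (σ :* (σ :* y) :- y) :+ σ :* M) refl

    -- The weights have to dominate only on the other elements of the bucket. Hence in a row where u
    -- and v do not collide, both may be given weight 0.
    ∣noise∣≤ : ∀ h s y u {z} → (∀ w → w ≢ u → lookup h w ≡ lookup h u → ∣ y w ∣ ≤ z w) →
               (∀ w → 0ℚ ≤ z w) → ∣ noise h s y u ∣ ≤ mass u z h
    ∣noise∣≤ h s y u {z} y≤z 0≤z = ≤-trans (≤-reflexive (∣sgn*∣ (lookup s u) _))
      (≤-trans (∣sum∣≤ (λ w → hit h w u * off u (signed h s y) w)) (sum-mono-≤ bound))
      where
      bound : ∀ w → ∣ hit h w u * off u (signed h s y) w ∣ ≤ hit h w u * z w
      bound w with w ≟ u | lookup h w ≟ lookup h u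
      ... | yes _   | d     = ≤-trans (≤-reflexive (cong ∣_∣ (*-zeroʳ (𝟙 (does d))))) (0≤* (0≤𝟙 (does d)) (0≤z w))
      ... | no w≢u  | yes eq = ≤-trans
        (≤-reflexive (trans (cong ∣_∣ (*-identityˡ (signed h s y w))) (∣sgn*∣ (lookup s w) (y w))))
        (≤-trans (y≤z w w≢u eq) (≤-reflexive (sym (*-identityˡ (z w)))))
      ... | no _    | no _  = ≤-reflexive (trans (cong ∣_∣ (*-zeroˡ (signed h s y w))) (sym (*-zeroˡ (z w))))

    mass≤sum : ∀ u {z} → (∀ w → 0ℚ ≤ z w) → ∀ (h : Vec (Fin r) U) → mass u z h ≤ sum z
    mass≤sum u {z} 0≤z h = sum-mono-≤ bound
      where
      bound : ∀ w → hit h w u * z w ≤ z w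
      bound w with does (lookup h w ≟ lookup h u)
      ... | true  = ≤-reflexive (*-identityˡ (z w))
      ... | false = ≤-trans (≤-reflexive (*-zeroˡ (z w))) (0≤z w)

  -- Flipping the sign of one element

  flip : ∀ {U} → Fin U → Vec Sign U → Vec Sign U
  flip u s = updateAt s u opposite

  module _ {r U : ℕ} (h : Vec (Fin r) U) (s : Vec Sign U) (y : Fin U → ℚ) where

    signed-flip : ∀ {u w} → w ≢ u → signed h (flip u s) y w ≡ signed h s y w
    signed-flip {u} {w} w≢u = cong (λ t → sgn t * y w) (Vecₚ.lookup∘updateAt′ w u w≢u s)

    -- `off` removes `u` from the inner sum, so the flip reaches only the outer sign.
    noise-flip-self : ∀ u → noise h (flip u s) y u ≡ - noise h s y u
    noise-flip-self u = trans (cong₂ _*_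
        (trans (cong sgn (Vecₚ.lookup∘updateAt u s)) (sgn-opposite (lookup s u)))
        (mass-cong h u λ w _ → same w))
      (sym (neg-distribˡ-* (sgn (lookup s u)) (mass u (off u (signed h s y)) h)))
      where
      same : ∀ w → off u (signed h (flip u s) y) w ≡ off u (signed h s y) w
      same w with w ≟ u
      ... | yes _  = refl
      ... | no w≢u = signed-flip w≢u

    noise-flip-other : ∀ {u v} → u ≢ v → lookup h u ≢ lookup h v →
                       noise h (flip u s) y v ≡ noise h s y v
    noise-flip-other {u} {v} u≢v hu≢hv = cong₂ _*_
      (cong sgn (Vecₚ.lookup∘updateAt′ v u (u≢v ∘ sym) s))
      (mass-cong h v λ w hw≡hv → cong (if does (w ≟ v) then 0ℚ else_)
        (signed-flip λ { refl → hu≢hv hw≡hv }))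

  -- Cancellation over the signs

  module _ {A : Set} (as : List A) (φ : A → A) (inv : ∀ f → total (f ∘ φ) as ≡ total f as) where

    total-vectors-map : ∀ n f → total (f ∘ Vec.map φ) (vectors as n) ≡ total f (vectors as n)
    total-vectors-map zero    f = refl
    total-vectors-map (suc n) f = begin
      total (f ∘ Vec.map φ) (vectors as (suc n))
        ≡⟨ total-cartesianProductWith (f ∘ Vec.map φ) _∷_ as (vectors as n) ⟩
      total (λ a → total (λ v → f (φ a ∷ Vec.map φ v)) (vectors as n)) as
        ≡⟨ total-cong (λ a → total-vectors-map n (λ v → f (φ a ∷ v))) as ⟩
      total (λ a → total (λ v → f (φ a ∷ v)) (vectors as n)) as
        ≡⟨ inv (λ a → total (λ v → f (a ∷ v)) (vectors as n)) ⟩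
      total (λ a → total (λ v → f (a ∷ v)) (vectors as n)) as
        ≡⟨ total-cartesianProductWith f _∷_ as (vectors as n) ⟨
      total f (vectors as (suc n)) ∎
      where open ≡-Reasoning

  signs : List Sign
  signs = Sign.+ ∷ Sign.- ∷ []

  -- Flipping a coordinate permutes the sign vectors; stated for totals, this needs no explicit
  -- bijection of lists. At the head it swaps two summands.
  total-flip : ∀ {U} (u : Fin U) f → total (f ∘ flip u) (vectors signs U) ≡ total f (vectors signs U)
  total-flip {suc U} zero f = begin
    total (f ∘ flip zero) (vectors signs (suc U))
      ≡⟨ total-cartesianProductWith (f ∘ flip zero) _∷_ signs (vectors signs U) ⟩
    g Sign.- + (g Sign.+ + 0ℚ)
      ≡⟨ solve 2 (λ a b → a :+ (b :+ con 0ℚ) := b :+ (a :+ con 0ℚ)) refl (g Sign.-) (g Sign.+) ⟩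
    g Sign.+ + (g Sign.- + 0ℚ)
      ≡⟨ total-cartesianProductWith f _∷_ signs (vectors signs U) ⟨
    total f (vectors signs (suc U)) ∎
    where
    open ≡-Reasoning
    open +-*-Solver using (solve; _:+_; _:=_; con)
    g : Sign → ℚ
    g a = total (λ s → f (a ∷ s)) (vectors signs U)
  total-flip {suc U} (suc u) f = begin
    total (f ∘ flip (suc u)) (vectors signs (suc U))
      ≡⟨ total-cartesianProductWith (f ∘ flip (suc u)) _∷_ signs (vectors signs U) ⟩
    total (λ a → total (λ s → f (a ∷ flip u s)) (vectors signs U)) signs
      ≡⟨ total-cong (λ a → total-flip u (λ s → f (a ∷ s))) signs ⟩
    total (λ a → total (λ s → f (a ∷ s)) (vectors signs U)) signs
      ≡⟨ total-cartesianProductWith f _∷_ signs (vectors signs U) ⟨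
    total f (vectors signs (suc U)) ∎
    where open ≡-Reasoning

  p≡-p⇒p≡0 : ∀ {p} → p ≡ - p → p ≡ 0ℚ
  p≡-p⇒p≡0 {p} p≡-p with ≤-total 0ℚ p
  ... | inj₁ 0≤p = ≤-antisym (subst (_≤ 0ℚ) (sym p≡-p) (neg-antimono-≤ 0≤p)) 0≤p
  ... | inj₂ p≤0 = ≤-antisym p≤0 (subst (0ℚ ≤_) (sym p≡-p) (neg-antimono-≤ p≤0))

  module _ {r U : ℕ} (y : Fin U → ℚ) where

    error : Vec (Vec (Fin r) U) 5 → Vec (Vec Sign U) 5 → Fin U → ℚ
    error H T u = median₅ (λ a → noise (lookup H a) (lookup T a) y u)

    module _ {u v : Fin U} (u≢v : u ≢ v) (H : Vec (Vec (Fin r) U) 5)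
             (apart : ∀ a → lookup (lookup H a) u ≢ lookup (lookup H a) v) where

      error-flip : ∀ T → error H (Vec.map (flip u) T) u * error H (Vec.map (flip u) T) v
                       ≡ - 1ℚ * (error H T u * error H T v)
      error-flip T = trans (cong₂ _*_
          (trans (median₅-cong λ a → trans
              (cong (λ s → noise (lookup H a) s y u) (Vecₚ.lookup-map a (flip u) T))
              (noise-flip-self (lookup H a) (lookup T a) y u))
            (median₅-neg (λ a → noise (lookup H a) (lookup T a) y u)))
          (median₅-cong λ a → trans
            (cong (λ s → noise (lookup H a) s y v) (Vecₚ.lookup-map a (flip u) T))
            (noise-flip-other (lookup H a) (lookup T a) y u≢v (apart a))))
        (solve 2 (λ p q → :- p :* q := con (- 1ℚ) :* (p :* q)) refl (error H T u) (error H T v))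
        where open +-*-Solver

      total-errors-apart : total (λ T → error H T u * error H T v) (vectors (vectors signs U) 5) ≡ 0ℚ
      total-errors-apart = p≡-p⇒p≡0 (begin
        total E Ts
          ≡⟨ total-vectors-map (vectors signs U) (flip u) (total-flip u) 5 E ⟨
        total (E ∘ Vec.map (flip u)) Ts
          ≡⟨ total-cong error-flip Ts ⟩
        total (λ T → - 1ℚ * E T) Ts
          ≡⟨ total-*ˡ (- 1ℚ) E Ts ⟩
        - 1ℚ * total E Ts
          ≡⟨ trans (sym (neg-distribˡ-* 1ℚ (total E Ts))) (cong -_ (*-identityˡ (total E Ts))) ⟩
        - total E Ts ∎)
        where
        open ≡-Reasoning
        Ts = vectors (vectors signs U) 5
        E : Vec (Vec Sign U) 5 → ℚ
        E T = error H T u * error H T v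

  -- The correlation of the medians

  ¼ 3ℚ 5ℚ 6ℚ 7ℚ 20ℚ 30ℚ 50ℚ 70ℚ : ℚ
  ¼   = ½ * ½
  3ℚ  = ℤ.+ 3 / 1
  5ℚ  = ℤ.+ 5 / 1
  6ℚ  = ℤ.+ 6 / 1
  7ℚ  = ℤ.+ 7 / 1
  20ℚ = ℤ.+ 20 / 1
  30ℚ = ℤ.+ 30 / 1
  50ℚ = ℤ.+ 50 / 1
  70ℚ = ℤ.+ 70 / 1

  module Collision {r U : ℕ} (y : Fin U → ℚ) {u v : Fin U} (u≢v : u ≢ v) where

    Row : Set
    Row = Vec (Fin r) U

    -- `z₁` deletes u, whose own value never enters its noise. `z₂` deletes v as well and serves the
    -- rows in which u and v do not collide.
    ∣y∣ z₁ z₂ : Fin U → ℚ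
    ∣y∣ w = ∣ y w ∣
    z₁ = off u ∣y∣
    z₂ = off v z₁

    X : ℚ
    X = sum ∣y∣

    -- `K` indicates a collision. `P` bounds the noise of u in any row; `A` and `B` bound the noises
    -- of u and v in a row where they do not collide.
    K P A B : Row → ℚ
    K h = hit h u v
    P = mass u z₁
    A = mass u z₂
    B = mass v z₂

    -- The bound on |err u · err v| for the rows other than a given colliding
    -- one.  The first summand takes care of the case that no other row
    -- collides; the second one counts unordered pairs of colliding rows twice.
    others : Vec Row 4 → ℚ
    others H = ¼ * (entries A H * entries B H)
             + ½ * X * sum (λ b → K (lookup H b) * entries P (removeAt H b))

    -- A union bound over the colliding row. All summands are nonnegative, so those of actual
    -- collisions already dominate the product of the errors; and in each product the collision
    -- factors and the masses read different rows, so its total factors.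
    bound : Vec Row 5 → ℚ
    bound H = sum (λ a → K (lookup H a) * others (removeAt H a))

    0≤z₁ : ∀ w → 0ℚ ≤ z₁ w
    0≤z₁ = 0≤off u (λ w → 0≤∣p∣ (y w))

    0≤z₂ : ∀ w → 0ℚ ≤ z₂ w
    0≤z₂ = 0≤off v 0≤z₁

    0≤X : 0ℚ ≤ X
    0≤X = sum-0≤ λ w → 0≤∣p∣ (y w)

    sum-z₁≤X : sum z₁ ≤ X
    sum-z₁≤X = sum-mono-≤ (off≤ u λ w → 0≤∣p∣ (y w))

    sum-z₂≤X : sum z₂ ≤ X
    sum-z₂≤X = ≤-trans (sum-mono-≤ (off≤ v 0≤z₁)) sum-z₁≤X

    z₂-u : z₂ u ≡ 0ℚ
    z₂-u = trans (off-other z₁ u≢v) (off-self u ∣y∣)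

    0≤¼ : 0ℚ ≤ ¼
    0≤¼ = nonNegative⁻¹ ¼

    0≤½X : 0ℚ ≤ ½ * X
    0≤½X = 0≤* {½} {X} (nonNegative⁻¹ ½) 0≤X

    0≤entries : ∀ {n f} → (∀ h → 0ℚ ≤ f h) → ∀ (H : Vec Row n) → 0ℚ ≤ entries f H
    0≤entries 0≤f H = sum-0≤ λ i → 0≤f (lookup H i)

    0≤K : ∀ h → 0ℚ ≤ K h
    0≤K h = 0≤𝟙 (does (lookup h u ≟ lookup h v))

    K≡1 : ∀ {h} → lookup h u ≡ lookup h v → K h ≡ 1ℚ
    K≡1 {h} eq = cong 𝟙 (dec-true (lookup h u ≟ lookup h v) eq)

    0≤first : ∀ (H : Vec Row 4) → 0ℚ ≤ ¼ * (entries A H * entries B H)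
    0≤first H = 0≤* {¼} {entries A H * entries B H} 0≤¼
      (0≤* {entries A H} {entries B H} (0≤entries (0≤mass u 0≤z₂) H) (0≤entries (0≤mass v 0≤z₂) H))

    0≤pair : ∀ (H : Vec Row 4) b → 0ℚ ≤ K (lookup H b) * entries P (removeAt H b)
    0≤pair H b = 0≤* {K (lookup H b)} {entries P (removeAt H b)} (0≤K (lookup H b))
      (0≤entries (0≤mass u 0≤z₁) (removeAt H b))

    0≤second : ∀ (H : Vec Row 4) → 0ℚ ≤ ½ * X * sum (λ b → K (lookup H b) * entries P (removeAt H b))
    0≤second H = 0≤* {½ * X} {sum (λ b → K (lookup H b) * entries P (removeAt H b))} 0≤½X (sum-0≤ (0≤pair H))

    0≤others : ∀ H → 0ℚ ≤ others H
    0≤others H = 0≤+ {¼ * (entries A H * entries B H)}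
      {½ * X * sum (λ b → K (lookup H b) * entries P (removeAt H b))} (0≤first H) (0≤second H)

    0≤term : ∀ H a → 0ℚ ≤ K (lookup H a) * others (removeAt H a)
    0≤term H a = 0≤* {K (lookup H a)} {others (removeAt H a)} (0≤K (lookup H a)) (0≤others (removeAt H a))

    0≤bound : ∀ H → 0ℚ ≤ bound H
    0≤bound H = sum-0≤ (0≤term H)

    ∣noise∣≤P : ∀ (h : Row) s → ∣ noise h s y u ∣ ≤ P h
    ∣noise∣≤P h s = ∣noise∣≤ h s y u (λ w w≢u _ → ≤-reflexive (sym (off-other ∣y∣ w≢u))) 0≤z₁

    ∣noise∣≤X : ∀ (h : Row) s w → ∣ noise h s y w ∣ ≤ X
    ∣noise∣≤X h s w = ≤-trans (∣noise∣≤ h s y w (λ w′ _ _ → ≤-refl) (λ w′ → 0≤∣p∣ (y w′)))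
      (mass≤sum w (λ w′ → 0≤∣p∣ (y w′)) h)

    z₂-other : ∀ {w} → w ≢ u → w ≢ v → ∣ y w ∣ ≤ z₂ w
    z₂-other w≢u w≢v = ≤-reflexive (sym (trans (off-other z₁ w≢v) (off-other ∣y∣ w≢u)))

    -- Domination for a fixed outcome

    module _ (H : Vec Row 5) (T : Vec (Vec Sign U) 5) where

      private
        eᵘ = ∣ error y H T u ∣
        eᵛ = ∣ error y H T v ∣
        0≤eᵘ : 0ℚ ≤ eᵘ
        0≤eᵘ = 0≤∣p∣ (error y H T u)
        f : Fin U → Fin 5 → ℚ
        f w a = noise (lookup H a) (lookup T a) y w

        Collides : Fin 5 → Set
        Collides a = lookup (lookup H a) u ≡ lookup (lookup H a) v

      eᵛ≤X : eᵛ ≤ X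
      eᵛ≤X = median₅-bound (f v) (λ a → ∣noise∣≤X (lookup H a) (lookup T a) v)

      eᵘ≤entries-P : ∀ a b → eᵘ ≤ entries P (removeAt (removeAt H a) b)
      eᵘ≤entries-P a b = ≤-trans (median₅-omit₂ (f u) a b) (sum-mono-≤ λ j →
        ≤-trans (∣noise∣≤P (lookup H (punchIn a (punchIn b j))) (lookup T (punchIn a (punchIn b j))))
          (≤-reflexive (cong P (sym (trans (lookup-removeAt (removeAt H a) b j) (lookup-removeAt H a (punchIn b j)))))))

      -- Half of the product is charged to each ordering of the two colliding rows, matching the
      -- double count in `others`. Both rows are omitted from the bound on the error of u, which
      -- leaves masses independent of both collisions.
      two-collisions : ∀ {a c} → a ≢ c → Collides a → Collides c →
                       ½ * (eᵘ * eᵛ) ≤ K (lookup H a) * others (removeAt H a)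
      two-collisions {a} {c} a≢c collidesᵃ collidesᶜ = begin
        ½ * (eᵘ * eᵛ)
          ≤⟨ *-monoˡ {½} (nonNegative⁻¹ ½) (*-monoˡ {eᵘ} {eᵛ} {X} 0≤eᵘ eᵛ≤X) ⟩
        ½ * (eᵘ * X)
          ≡⟨ rearrange ½ eᵘ X ⟩
        ½ * X * eᵘ
          ≤⟨ *-monoˡ {½ * X} {eᵘ} {S} 0≤½X (≤-trans eᵘ≤pair (sum-≥-entry (0≤pair H′) b)) ⟩
        ½ * X * S
          ≤⟨ ≤-trans (≤-reflexive (sym (+-identityˡ (½ * X * S)))) (+-monoˡ-≤ (½ * X * S) (0≤first H′)) ⟩
        others H′
          ≡⟨ trans (cong (_* others H′) (K≡1 {lookup H a} collidesᵃ)) (*-identityˡ (others H′)) ⟨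
        K (lookup H a) * others H′ ∎
        where
        open ≤-Reasoning
        H′ = removeAt H a
        b  = punchOut a≢c
        S  = sum (λ b → K (lookup H′ b) * entries P (removeAt H′ b))
        Kb≡1 : K (lookup H′ b) ≡ 1ℚ
        Kb≡1 = trans (cong K (Vecₚ.removeAt-punchOut H a≢c)) (K≡1 {lookup H c} collidesᶜ)
        eᵘ≤pair : eᵘ ≤ K (lookup H′ b) * entries P (removeAt H′ b)
        eᵘ≤pair = ≤-trans (eᵘ≤entries-P a b) (≤-reflexive (sym
          (trans (cong (_* entries P (removeAt H′ b)) Kb≡1) (*-identityˡ (entries P (removeAt H′ b))))))
        rearrange : ∀ h e x → h * (e * x) ≡ h * x * e
        rearrange = solve 3 (λ h e x → h :* (e :* x) := h :* x :* e) refl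
          where open +-*-Solver

      -- All other rows are free of collisions, so the weights `z₂` suffice there for both errors.
      one-collision : ∀ {a} → Collides a → (∀ c → a ≢ c → ¬ Collides c) →
                      eᵘ * eᵛ ≤ K (lookup H a) * others (removeAt H a)
      one-collision {a} collides apart = begin
        eᵘ * eᵛ
          -- Omitting one row bounds twice the median, so each error enters doubled and `¼`
          -- compensates.
          ≡⟨ quarter eᵘ eᵛ ⟩
        ¼ * ((eᵘ + eᵘ) * (eᵛ + eᵛ))
          ≤⟨ *-monoˡ {¼} {(eᵘ + eᵘ) * (eᵛ + eᵛ)} {entries A H′ * entries B H′} 0≤¼ (*-mono (0≤+ 0≤eᵘ 0≤eᵘ) (0≤entries (0≤mass v 0≤z₂) H′)
               (≤-trans (median₅-omit₁ (f u) a) (sum-mono-≤ boundᵘ))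
               (≤-trans (median₅-omit₁ (f v) a) (sum-mono-≤ boundᵛ))) ⟩
        ¼ * (entries A H′ * entries B H′)
          ≤⟨ ≤-trans (≤-reflexive (sym (+-identityʳ (¼ * (entries A H′ * entries B H′))))) (+-monoʳ-≤ (¼ * (entries A H′ * entries B H′)) (0≤second H′)) ⟩
        others H′
          ≡⟨ trans (cong (_* others H′) (K≡1 {lookup H a} collides)) (*-identityˡ (others H′)) ⟨
        K (lookup H a) * others H′ ∎
        where
        open ≤-Reasoning
        H′ = removeAt H a
        quarter : ∀ p q → p * q ≡ ¼ * ((p + p) * (q + q))
        quarter = solve 2 (λ p q → p :* q := con ¼ :* ((p :+ p) :* (q :+ q))) refl
          where open +-*-Solver
        apart′ : ∀ j → ¬ Collides (punchIn a j)
        apart′ j = apart (punchIn a j) (Finₚ.punchInᵢ≢i a j ∘ sym)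
        boundᵘ : ∀ j → ∣ f u (punchIn a j) ∣ ⊓ eᵘ ≤ A (lookup H′ j)
        boundᵘ j = ≤-trans (p⊓q≤p ∣ f u (punchIn a j) ∣ eᵘ) (≤-trans
          (∣noise∣≤ (lookup H (punchIn a j)) (lookup T (punchIn a j)) y u
            (λ w w≢u hw≡hu → z₂-other w≢u λ { refl → apart′ j (sym hw≡hu) }) 0≤z₂)
          (≤-reflexive (cong A (sym (lookup-removeAt H a j)))))
        boundᵛ : ∀ j → ∣ f v (punchIn a j) ∣ ⊓ eᵛ ≤ B (lookup H′ j)
        boundᵛ j = ≤-trans (p⊓q≤p ∣ f v (punchIn a j) ∣ eᵛ) (≤-trans
          (∣noise∣≤ (lookup H (punchIn a j)) (lookup T (punchIn a j)) y v
            (λ w w≢v hw≡hv → z₂-other (λ { refl → apart′ j hw≡hv }) w≢v) 0≤z₂)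
          (≤-reflexive (cong B (sym (lookup-removeAt H a j)))))

      ∣errors∣≤bound : ∀ a → Collides a → ∣ error y H T u * error y H T v ∣ ≤ bound H
      ∣errors∣≤bound a collidesᵃ = ≤-trans (≤-reflexive (∣p*q∣≡∣p∣*∣q∣ (error y H T u) (error y H T v)))
        (by-cases (any? λ c → ¬? (a ≟ c) ×-dec (lookup (lookup H c) u ≟ lookup (lookup H c) v)))
        where
        open ≤-Reasoning
        term : Fin 5 → ℚ
        term a = K (lookup H a) * others (removeAt H a)
        by-cases : Dec (∃[ c ] a ≢ c × Collides c) → eᵘ * eᵛ ≤ bound H
        by-cases (yes (c , a≢c , collidesᶜ)) = begin
          eᵘ * eᵛ                       ≡⟨ halves (eᵘ * eᵛ) ⟩
          ½ * (eᵘ * eᵛ) + ½ * (eᵘ * eᵛ) ≤⟨ +-mono-≤ (two-collisions a≢c collidesᵃ collidesᶜ)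
                                                     (two-collisions (a≢c ∘ sym) collidesᶜ collidesᵃ) ⟩
          term a + term c               ≤⟨ sum-≥-pair (0≤term H) a≢c ⟩
          bound H                       ∎
          where
          halves : ∀ p → p ≡ ½ * p + ½ * p
          halves = solve 1 (λ p → p := con ½ :* p :+ con ½ :* p) refl
            where open +-*-Solver
        by-cases (no none) = ≤-trans (one-collision collidesᵃ λ c a≢c collidesᶜ → none (c , a≢c , collidesᶜ))
                                (sum-≥-entry (0≤term H) a)

    -- The signs are summed with the hash values fixed: without a collision they cancel, and with
    -- one the bound holds for every choice of signs.
    ∣total-errors∣≤ : ∀ H → let Ts = vectors (vectors signs U) 5 in
      ∣ total (λ T → error y H T u * error y H T v) Ts ∣ ≤ card Ts * bound H
    ∣total-errors∣≤ H = by-cases (any? λ a → lookup (lookup H a) u ≟ lookup (lookup H a) v)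
      where
      open ≤-Reasoning
      Ts = vectors (vectors signs U) 5
      E : Vec (Vec Sign U) 5 → ℚ
      E T = error y H T u * error y H T v
      by-cases : Dec (∃[ a ] lookup (lookup H a) u ≡ lookup (lookup H a) v) →
                 ∣ total E Ts ∣ ≤ card Ts * bound H
      by-cases (yes (a , collides)) = begin
        ∣ total E Ts ∣                ≤⟨ ∣total∣≤ E Ts ⟩
        total (∣_∣ ∘ E) Ts            ≤⟨ total-mono-≤ (λ T → ∣errors∣≤bound H T a collides) Ts ⟩
        total (λ _ → bound H) Ts      ≡⟨ total-const (bound H) Ts ⟩
        card Ts * bound H             ∎
      by-cases (no none) = ≤-trans
        (≤-reflexive (cong ∣_∣ (total-errors-apart y u≢v H λ a collides → none (a , collides))))
        (0≤* (0≤card Ts) (0≤bound H))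

    -- Summing the bound over all hash values

    rows : List Row
    rows = vectors (allFin r) U

    private
      R N k a b p q Z Z₁ : ℚ
      R = card (allFin r)
      N = card rows
      k = total K rows
      a = total A rows
      b = total B rows
      p = total P rows
      q = total (λ h → A h * B h) rows
      Z = sum z₂
      Z₁ = sum z₁

      -- The collision probability 1/r with denominators cleared; the identities that follow are
      -- expected masses in the same form.
      Rk : R * k ≡ N
      Rk = trans (cong (R *_) (total-cong (λ h → sym (*-identityʳ (K h))) rows))
        (resample (u≢v ∘ sym) (λ _ → 1ℚ) λ _ _ _ → refl)

      total-mass₁ : ∀ w z → z w ≡ 0ℚ → R * total (mass w z) rows ≡ sum z * N
      total-mass₁ w z zw≡0 = trans (cong (R *_) (total-cong (λ h → sym (*-identityʳ (mass w z h))) rows))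
        (total-mass w z zw≡0 (λ _ → 1ℚ) λ _ _ _ → refl)

      Ra : R * a ≡ Z * N
      Ra = total-mass₁ u z₂ z₂-u
      Rb : R * b ≡ Z * N
      Rb = total-mass₁ v z₂ (off-self v z₁)
      Rp : R * p ≡ Z₁ * N
      Rp = total-mass₁ u z₁ (off-self u ∣y∣)
      -- Both masses live in the same row, yet each brings its own factor 1/r: `z₂` gives u weight
      -- 0, so `B` is independent of the hash of u.
      Rq : R * q ≡ Z * b
      Rq = total-mass u z₂ z₂-u B (mass-ignores z₂ (u≢v ∘ sym) z₂-u)

      N₂ : ℚ
      N₂ = card (vectors rows 2)

      total-others : total others (vectors rows 4) ≡
        ¼ * (sum {4} (λ _ → q * (N * N₂)) + sum {4} (λ _ → a * sum {3} (λ _ → b * N₂)))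
          + ½ * X * sum {4} (λ _ → k * sum {3} (λ _ → p * N₂))
      total-others = trans (total-+ (λ H → ¼ * (entries A H * entries B H))
          (λ H → ½ * X * sum (λ b → K (lookup H b) * entries P (removeAt H b))) V₄) (cong₂ _+_
        (trans (total-*ˡ ¼ (λ H → entries A H * entries B H) V₄) (cong (¼ *_)
          (trans (total-entries² rows 3 A B) (cong₂ _+_
            (cong (λ t → sum {4} (λ _ → q * t)) (card-vectors rows 2))
            (cong (λ t → sum {4} (λ _ → a * t)) (total-entries rows 2 B))))))
        (trans (total-*ˡ (½ * X) (λ H → sum (λ b → K (lookup H b) * entries P (removeAt H b))) V₄)
          (cong (½ * X *_) (trans (total-sum-removeAt rows K (entries P))
            (cong (λ t → sum {4} (λ _ → k * t)) (total-entries rows 2 P))))))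
        where V₄ = vectors rows 4

      -- Hands one factor R to each collision and each mass. The coefficients are ¼ · 4 = 1 for two
      -- masses in one row, ¼ · 4 · 3 = 3 for masses in two rows and ½ · 4 · 3 = 6 for a second
      -- collision, all times 5 for the choice of the first colliding row.
      scale : ∀ R k a b p q N c X →
        R * (R * R) * sum {5} (λ _ → k *
          (¼ * (sum {4} (λ _ → q * (N * c)) + sum {4} (λ _ → a * sum {3} (λ _ → b * c)))
            + ½ * X * sum {4} (λ _ → k * sum {3} (λ _ → p * c))))
        ≡ 5ℚ * (R * k) * (R * (R * q) * (N * c) + 3ℚ * ((R * a) * (R * b)) * c + 6ℚ * X * ((R * k) * (R * p)) * c)
      scale = solve 9 (λ R k a b p q N c X →
        R :* (R :* R) :* five (k :*
          (con ¼ :* (four (q :* (N :* c)) :+ four (a :* three (b :* c)))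
            :+ con ½ :* X :* four (k :* three (p :* c))))
        := con 5ℚ :* (R :* k) :* (R :* (R :* q) :* (N :* c) :+ con 3ℚ :* ((R :* a) :* (R :* b)) :* c
                                  :+ con 6ℚ :* X :* ((R :* k) :* (R :* p)) :* c)) refl
        where
        open +-*-Solver
        -- `sum` of a constant family unfolds to nested additions ending in `0ℚ`; these copy that
        -- shape for the solver.
        three four five : ∀ {n} → Polynomial n → Polynomial n
        three t = t :+ (t :+ (t :+ con 0ℚ))
        four  t = t :+ three t
        five  t = t :+ four t

      collect : ∀ N Z Z₁ c X →
        5ℚ * N * (Z * (Z * N) * (N * c) + 3ℚ * ((Z * N) * (Z * N)) * c + 6ℚ * X * (N * (Z₁ * N)) * c)
        ≡ (20ℚ * (Z * Z) + 30ℚ * (X * Z₁)) * (N * (N * (N * c)))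
      collect = solve 5 (λ N Z Z₁ c X →
        con 5ℚ :* N :* (Z :* (Z :* N) :* (N :* c) :+ con 3ℚ :* ((Z :* N) :* (Z :* N)) :* c
                         :+ con 6ℚ :* X :* (N :* (Z₁ :* N)) :* c)
        := (con 20ℚ :* (Z :* Z) :+ con 30ℚ :* (X :* Z₁)) :* (N :* (N :* (N :* c)))) refl
        where open +-*-Solver

      RRq : R * (R * q) ≡ Z * (Z * N)
      RRq = trans (cong (R *_) Rq) (trans (*-exchange R Z b) (cong (Z *_) Rb))

    total-bound : R * (R * R) * total bound (vectors rows 5)
      ≡ (20ℚ * (Z * Z) + 30ℚ * (X * Z₁)) * card (vectors rows 5)
    total-bound = begin
      R * (R * R) * total bound (vectors rows 5)
        ≡⟨ cong (R * (R * R) *_) (trans (total-sum-removeAt rows K others)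
             (cong (λ t → sum {5} (λ _ → k * t)) total-others)) ⟩
      R * (R * R) * sum {5} (λ _ → k *
        (¼ * (sum {4} (λ _ → q * (N * N₂)) + sum {4} (λ _ → a * sum {3} (λ _ → b * N₂)))
          + ½ * X * sum {4} (λ _ → k * sum {3} (λ _ → p * N₂))))
        ≡⟨ scale R k a b p q N N₂ X ⟩
      5ℚ * (R * k) * (R * (R * q) * (N * N₂) + 3ℚ * ((R * a) * (R * b)) * N₂ + 6ℚ * X * ((R * k) * (R * p)) * N₂)
        ≡⟨ cong₂ (λ s t → 5ℚ * s * (t * (N * N₂) + 3ℚ * ((R * a) * (R * b)) * N₂ + 6ℚ * X * (s * (R * p)) * N₂)) Rk RRq ⟩
      5ℚ * N * (Z * (Z * N) * (N * N₂) + 3ℚ * ((R * a) * (R * b)) * N₂ + 6ℚ * X * (N * (R * p)) * N₂)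
        ≡⟨ cong₂ (λ s t → 5ℚ * N * (Z * (Z * N) * (N * N₂) + 3ℚ * s * N₂ + 6ℚ * X * (N * t) * N₂)) (cong₂ _*_ Ra Rb) Rp ⟩
      5ℚ * N * (Z * (Z * N) * (N * N₂) + 3ℚ * ((Z * N) * (Z * N)) * N₂ + 6ℚ * X * (N * (Z₁ * N)) * N₂)
        ≡⟨ collect N Z Z₁ N₂ X ⟩
      (20ℚ * (Z * Z) + 30ℚ * (X * Z₁)) * (N * (N * (N * N₂)))
        ≡⟨ cong ((20ℚ * (Z * Z) + 30ℚ * (X * Z₁)) *_) (sym card₅) ⟩
      (20ℚ * (Z * Z) + 30ℚ * (X * Z₁)) * card (vectors rows 5) ∎
      where
      open ≡-Reasoning
      card₅ : card (vectors rows 5) ≡ N * (N * (N * N₂))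
      card₅ = trans (card-vectors rows 4) (cong (N *_) (trans (card-vectors rows 3)
        (cong (N *_) (card-vectors rows 2))))

    total-bound-≤ : R * (R * R) * total bound (vectors rows 5) ≤ 70ℚ * (X * X) * card (vectors rows 5)
    total-bound-≤ = ≤-trans (≤-reflexive total-bound)
      (*-monoʳ-≤-nonNeg (card V₅) {{nonNegative (0≤card V₅)}} (begin
        20ℚ * (Z * Z) + 30ℚ * (X * Z₁)
          ≤⟨ +-mono-≤ (*-monoˡ {20ℚ} (nonNegative⁻¹ 20ℚ) (*-mono (sum-0≤ 0≤z₂) 0≤X sum-z₂≤X sum-z₂≤X))
                      (*-monoˡ {30ℚ} (nonNegative⁻¹ 30ℚ) (*-monoˡ 0≤X sum-z₁≤X)) ⟩
        20ℚ * (X * X) + 30ℚ * (X * X)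
          ≡⟨ *-distribʳ-+ (X * X) 20ℚ 30ℚ ⟨
        50ℚ * (X * X)
          -- The argument yields 20 + 30 = 50; here the constant is relaxed to 70.
          ≤⟨ *-monoʳ-≤-nonNeg (X * X) {{nonNegative (0≤* 0≤X 0≤X)}} (≤ᵇ⇒≤ {50ℚ} {70ℚ} _) ⟩
        70ℚ * (X * X) ∎))
      where
      open ≤-Reasoning
      V₅ = vectors rows 5

  -- From totals to means

  /-* : ∀ i n .{{_ : ℕ.NonZero n}} → (i / n) * (ℤ.+ n / 1) ≡ i / 1
  /-* i (suc n) = toℚᵘ-injective (begin
    toℚᵘ ((i / suc n) * (ℤ.+ suc n / 1))                  ≈⟨ toℚᵘ-homo-* (i / suc n) (ℤ.+ suc n / 1) ⟩
    toℚᵘ (i / suc n) ℚᵘ.* toℚᵘ (ℤ.+ suc n / 1)            ≈⟨ ℚᵘₚ.*-cong (toℚᵘ-fromℚᵘ (ℚᵘ.mkℚᵘ i n)) (toℚᵘ-fromℚᵘ (ℚᵘ.mkℚᵘ (ℤ.+ suc n) 0)) ⟩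
    ℚᵘ.mkℚᵘ i n ℚᵘ.* ℚᵘ.mkℚᵘ (ℤ.+ suc n) 0                ≈⟨ ℚᵘ.*≡* (trans (ℤₚ.*-identityʳ (i ℤ.* ℤ.+ suc n)) (cong (i ℤ.*_) (cong ℤ.+_ (sym (ℕₚ.*-identityʳ (suc n)))))) ⟩
    ℚᵘ.mkℚᵘ i 0                                         ≈⟨ toℚᵘ-fromℚᵘ (ℚᵘ.mkℚᵘ i 0) ⟨
    toℚᵘ (i / 1)                                        ∎)
    where open ℚᵘₚ.≃-Reasoning

  /1-+ : ∀ m n → ℤ.+ (m ℕ.+ n) / 1 ≡ ℤ.+ m / 1 + ℤ.+ n / 1
  /1-+ m n = toℚᵘ-injective (begin
    toℚᵘ (ℤ.+ (m ℕ.+ n) / 1)                              ≈⟨ toℚᵘ-fromℚᵘ (ℚᵘ.mkℚᵘ (ℤ.+ (m ℕ.+ n)) 0) ⟩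
    ℚᵘ.mkℚᵘ (ℤ.+ (m ℕ.+ n)) 0                             ≈⟨ ℚᵘ.*≡* (cong (ℤ._* ℤ.+ 1) (sym (cong₂ ℤ._+_ (ℤₚ.*-identityʳ (ℤ.+ m)) (ℤₚ.*-identityʳ (ℤ.+ n))))) ⟩
    ℚᵘ.mkℚᵘ (ℤ.+ m) 0 ℚᵘ.+ ℚᵘ.mkℚᵘ (ℤ.+ n) 0                ≈⟨ ℚᵘₚ.+-cong (toℚᵘ-fromℚᵘ (ℚᵘ.mkℚᵘ (ℤ.+ m) 0)) (toℚᵘ-fromℚᵘ (ℚᵘ.mkℚᵘ (ℤ.+ n) 0)) ⟨
    toℚᵘ (ℤ.+ m / 1) ℚᵘ.+ toℚᵘ (ℤ.+ n / 1)                  ≈⟨ toℚᵘ-homo-+ (ℤ.+ m / 1) (ℤ.+ n / 1) ⟨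
    toℚᵘ (ℤ.+ m / 1 + ℤ.+ n / 1)                            ∎)
    where open ℚᵘₚ.≃-Reasoning

  /1-* : ∀ m n → ℤ.+ (m ℕ.* n) / 1 ≡ (ℤ.+ m / 1) * (ℤ.+ n / 1)
  /1-* zero    n = sym (*-zeroˡ (ℤ.+ n / 1))
  /1-* (suc m) n = begin
    ℤ.+ (n ℕ.+ m ℕ.* n) / 1             ≡⟨ /1-+ n (m ℕ.* n) ⟩
    ℤ.+ n / 1 + ℤ.+ (m ℕ.* n) / 1         ≡⟨ cong₂ _+_ (sym (*-identityˡ (ℤ.+ n / 1))) (/1-* m n) ⟩
    1ℚ * (ℤ.+ n / 1) + (ℤ.+ m / 1) * (ℤ.+ n / 1) ≡⟨ *-distribʳ-+ (ℤ.+ n / 1) 1ℚ (ℤ.+ m / 1) ⟨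
    (1ℚ + ℤ.+ m / 1) * (ℤ.+ n / 1)        ≡⟨ cong (_* (ℤ.+ n / 1)) (/1-+ 1 m) ⟨
    (ℤ.+ suc m / 1) * (ℤ.+ n / 1)         ∎
    where open ≡-Reasoning

  /1-cube : ∀ n → ℤ.+ (n ℕ.^ 3) / 1 ≡ (ℤ.+ n / 1) * ((ℤ.+ n / 1) * (ℤ.+ n / 1))
  /1-cube n = trans (/1-* n (n ℕ.^ 2)) (cong ((ℤ.+ n / 1) *_)
    (trans (/1-* n (n ℕ.* 1)) (cong (λ k → (ℤ.+ n / 1) * (ℤ.+ k / 1)) (ℕₚ.*-identityʳ n))))

  card-length : ∀ {A : Set} (xs : List A) → card xs ≡ ℤ.+ List.length xs / 1
  card-length []       = refl
  card-length (x ∷ xs) = trans (cong (λ c → 1ℚ + c) (card-length xs)) (sym (/1-+ 1 (List.length xs)))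

  mean : List ℚ → ℚ
  mean []         = 0ℚ
  mean xs@(_ ∷ _) = (ℤ.+ 1 / List.length xs) * sumₗ xs

  mean-≤ : ∀ c {b} xs → 0ℚ ≤ b → c * ∣ sumₗ xs ∣ ≤ b * (ℤ.+ List.length xs / 1) → c * ∣ mean xs ∣ ≤ b
  -- The empty list arises for r = 0 and an inhabited universe; its mean is 0 by convention.
  mean-≤ c {b} [] 0≤b _ = ≤-trans (≤-reflexive (*-zeroʳ c)) 0≤b
  mean-≤ c {b} xs@(_ ∷ _) 0≤b le = begin
    c * ∣ i * sumₗ xs ∣       ≡⟨ cong (c *_) (trans (∣p*q∣≡∣p∣*∣q∣ i (sumₗ xs)) (cong (_* ∣ sumₗ xs ∣) (0≤p⇒∣p∣≡p 0≤i))) ⟩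
    c * (i * ∣ sumₗ xs ∣)     ≡⟨ *-exchange c i ∣ sumₗ xs ∣ ⟩
    i * (c * ∣ sumₗ xs ∣)     ≤⟨ *-monoˡ 0≤i le ⟩
    i * (b * n)               ≡⟨ *-exchange i b n ⟩
    b * (i * n)               ≡⟨ trans (cong (b *_) (/-* (ℤ.+ 1) (List.length xs))) (*-identityʳ b) ⟩
    b                         ∎
    where
    open ≤-Reasoning
    i = ℤ.+ 1 / List.length xs
    n = ℤ.+ List.length xs / 1
    0≤i : 0ℚ ≤ i
    0≤i = nonNegative⁻¹ i {{normalize-nonNeg 1 (List.length xs)}}

  module _ {r U : ℕ} (y : Fin U → ℚ) {u v : Fin U} (u≢v : u ≢ v) where

    open Collision {r} y u≢v

    errors : Outcome 5 U r → ℚ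
    errors ω = error y (Outcome.hashes ω) (Outcome.signs ω) u * error y (Outcome.hashes ω) (Outcome.signs ω) v

    private
      Ω  = outcomes 5 U r
      Hs = vectors rows 5
      Ts = vectors (vectors signs U) 5
      R  = ℤ.+ r / 1
      R³ = R * (R * R)

      0≤R : 0ℚ ≤ R
      0≤R = nonNegative⁻¹ R {{normalize-nonNeg r 1}}

      0≤R³ : 0ℚ ≤ R³
      0≤R³ = 0≤* 0≤R (0≤* 0≤R 0≤R)

      card-r : card (allFin r) ≡ R
      card-r = trans (card-length (allFin r)) (cong (λ n → ℤ.+ n / 1) (Listₚ.length-tabulate {n = r} (λ i → i)))

      card-Ω : card Ω ≡ card Hs * card Ts
      card-Ω = trans (total-cartesianProductWith (λ _ → 1ℚ) mkOutcome Hs Ts) (total-const (card Ts) Hs)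

      ∣total-outcomes∣≤ : ∣ total errors Ω ∣ ≤ card Ts * total bound Hs
      ∣total-outcomes∣≤ = begin
        ∣ total errors Ω ∣
          ≡⟨ cong ∣_∣ (total-cartesianProductWith errors mkOutcome Hs Ts) ⟩
        ∣ total (λ H → total (λ T → errors (mkOutcome H T)) Ts) Hs ∣
          ≤⟨ ∣total∣≤ (λ H → total (λ T → errors (mkOutcome H T)) Ts) Hs ⟩
        total (λ H → ∣ total (λ T → errors (mkOutcome H T)) Ts ∣) Hs
          ≤⟨ total-mono-≤ ∣total-errors∣≤ Hs ⟩
        total (λ H → card Ts * bound H) Hs
          ≡⟨ total-*ˡ (card Ts) bound Hs ⟩
        card Ts * total bound Hs ∎
        where open ≤-Reasoning

    ∣mean-errors∣≤ : R³ * ∣ mean (List.map errors Ω) ∣ ≤ 70ℚ * (X * X)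
    ∣mean-errors∣≤ = mean-≤ R³ (List.map errors Ω) (0≤* (nonNegative⁻¹ 70ℚ) (0≤* 0≤X 0≤X)) (begin
      R³ * ∣ total errors Ω ∣
        ≤⟨ *-monoˡ 0≤R³ ∣total-outcomes∣≤ ⟩
      R³ * (card Ts * total bound Hs)
        ≡⟨ *-exchange R³ (card Ts) (total bound Hs) ⟩
      card Ts * (R³ * total bound Hs)
        ≤⟨ *-monoˡ (0≤card Ts) (subst (λ R → R * (R * R) * total bound Hs ≤ 70ℚ * (X * X) * card Hs) card-r total-bound-≤) ⟩
      card Ts * (70ℚ * (X * X) * card Hs)
        ≡⟨ rearrange (card Ts) (70ℚ * (X * X)) (card Hs) ⟩
      70ℚ * (X * X) * (card Hs * card Ts)
        ≡⟨ cong (70ℚ * (X * X) *_) (trans (sym card-Ω) (trans (card-length Ω)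
             (cong (λ n → ℤ.+ n / 1) (sym (Listₚ.length-map errors Ω))))) ⟩
      70ℚ * (X * X) * (ℤ.+ List.length (List.map errors Ω) / 1) ∎)
      where
      open ≤-Reasoning
      open +-*-Solver using (solve; _:*_; _:=_)
      rearrange : ∀ a b c → a * (b * c) ≡ b * (c * a)
      rearrange = solve 3 (λ a b c → a :* (b :* c) := b :* (c :* a)) refl

  -- The hypothesis on t · s has slack θ because 1 / t ≤ s is only known in the limit.
  cube-≤ : ∀ {t s θ c m} → 0ℚ ≤ t → 1ℚ ≤ s → 0ℚ ≤ θ → θ ≤ 1ℚ → 0ℚ ≤ c →
    1ℚ ≤ t * (s + θ) → s * (s * s) * m ≤ c → m ≤ t * (t * t) * c + 7ℚ * θ * (t * (t * t) * c)
  cube-≤ {t} {s} {θ} {c} {m} 0≤t 1≤s 0≤θ θ≤1 0≤c 1≤ts s³m≤c =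
    *-cancelˡ-≤-pos s³ {{positive 0<s³}} (begin
      s³ * m
        ≤⟨ s³m≤c ⟩
      c
        ≡⟨ *-identityˡ c ⟨
      1ℚ * c
        ≤⟨ *-monoʳ-≤-nonNeg c {{nonNegative 0≤c}} 1≤g³ ⟩
      g * (g * g) * c
        ≡⟨ expand t s θ c ⟩
      s³ * (t³ * c + (3ℚ * θ + 3ℚ * (θ * θ) + θ * (θ * θ)) * (t³ * c))
        ≤⟨ *-monoˡ (<⇒≤ 0<s³) (+-monoʳ-≤ (t³ * c)
             (*-monoʳ-≤-nonNeg (t³ * c) {{nonNegative 0≤t³c}} small)) ⟩
      s³ * (t³ * c + 7ℚ * θ * (t³ * c)) ∎)
    where
    open ≤-Reasoning
    open +-*-Solver using (solve; _:+_; _:*_; _:=_; con)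
    0≤1 : 0ℚ ≤ 1ℚ
    0≤1 = nonNegative⁻¹ 1ℚ
    0<s : 0ℚ < s
    0<s = <-≤-trans (positive⁻¹ 1ℚ) 1≤s
    -- As 1 ≤ s, the additive slack becomes a relative one: t(s + θ) ≤ g. Thus 1 ≤ g³, and the
    -- factor s³ contained in g³ cancels.
    s³ t³ g : ℚ
    s³ = s * (s * s)
    t³ = t * (t * t)
    g  = t * (s * (1ℚ + θ))
    0<* : ∀ {p q} → 0ℚ < p → 0ℚ < q → 0ℚ < p * q
    0<* {p} {q} 0<p 0<q = positive⁻¹ (p * q) {{pos*pos⇒pos p {{positive 0<p}} q {{positive 0<q}}}}
    0<s³ : 0ℚ < s³
    0<s³ = 0<* 0<s (0<* 0<s 0<s)
    0≤t³c : 0ℚ ≤ t³ * c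
    0≤t³c = 0≤* (0≤* 0≤t (0≤* 0≤t 0≤t)) 0≤c
    1≤g : 1ℚ ≤ g
    1≤g = ≤-trans 1≤ts (*-monoˡ 0≤t (begin
      s + θ        ≡⟨ cong (λ p → s + p) (*-identityˡ θ) ⟨
      s + 1ℚ * θ   ≤⟨ +-monoʳ-≤ s (*-monoʳ-≤-nonNeg θ {{nonNegative 0≤θ}} 1≤s) ⟩
      s + s * θ    ≡⟨ solve 2 (λ s θ → s :+ s :* θ := s :* (con 1ℚ :+ θ)) refl s θ ⟩
      s * (1ℚ + θ) ∎))
    1≤* : ∀ {p q} → 1ℚ ≤ p → 1ℚ ≤ q → 1ℚ ≤ p * q
    1≤* {p} {q} 1≤p 1≤q = ≤-trans 1≤q (≤-trans (≤-reflexive (sym (*-identityˡ q)))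
      (*-monoʳ-≤-nonNeg q {{nonNegative (≤-trans 0≤1 1≤q)}} 1≤p))
    1≤g³ : 1ℚ ≤ g * (g * g)
    1≤g³ = 1≤* 1≤g (1≤* 1≤g 1≤g)
    θθ≤θ : θ * θ ≤ θ
    θθ≤θ = ≤-trans (*-monoˡ 0≤θ θ≤1) (≤-reflexive (*-identityʳ θ))
    θθθ≤θ : θ * (θ * θ) ≤ θ
    θθθ≤θ = ≤-trans (*-monoˡ 0≤θ (≤-trans θθ≤θ θ≤1)) (≤-reflexive (*-identityʳ θ))
    -- The left side is (1 + θ)³ - 1; since θ ≤ 1, its higher powers are at most θ, whence 7 = 3 + 3
    -- + 1.
    small : 3ℚ * θ + 3ℚ * (θ * θ) + θ * (θ * θ) ≤ 7ℚ * θ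
    small = begin
      3ℚ * θ + 3ℚ * (θ * θ) + θ * (θ * θ) ≤⟨ +-mono-≤ (+-monoʳ-≤ (3ℚ * θ) (*-monoˡ {3ℚ} (nonNegative⁻¹ 3ℚ) θθ≤θ)) θθθ≤θ ⟩
      3ℚ * θ + 3ℚ * θ + θ                 ≡⟨ solve 1 (λ θ → con 3ℚ :* θ :+ con 3ℚ :* θ :+ θ := con 7ℚ :* θ) refl θ ⟩
      7ℚ * θ                              ∎
    expand : ∀ t s θ c → let g = t * (s * (1ℚ + θ)); t³ = t * (t * t) in
      g * (g * g) * c ≡ s * (s * s) * (t³ * c + (3ℚ * θ + 3ℚ * (θ * θ) + θ * (θ * θ)) * (t³ * c))
    expand = solve 4 (λ t s θ c → let g = t :* (s :* (con 1ℚ :+ θ)); t³ = t :* (t :* t) in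
      g :* (g :* g) :* c :=
      s :* (s :* s) :* (t³ :* c :+ (con 3ℚ :* θ :+ con 3ℚ :* (θ :* θ) :+ θ :* (θ :* θ)) :* (t³ :* c))) refl

  -- Take θ = e / (7b + e): the summand e of the denominator gives θ ≤ 1, the summand 7b gives the
  -- last bound.
  slack : ∀ {b e} → 0ℚ < b → 0ℚ < e → ∃[ θ ] (0ℚ < θ × θ ≤ 1ℚ × 7ℚ * θ * b ≤ e)
  slack {b} {e} 0<b 0<e = e * i
    , positive⁻¹ (e * i) {{pos*pos⇒pos e {{positive 0<e}} i {{i>0}}}}
    , ≤-trans (*-monoʳ-≤-nonNeg i e≤D) (≤-reflexive D*i≡1)
    , (begin
        7ℚ * (e * i) * b   ≡⟨ rearrange e i b ⟩
        e * (7ℚ * b * i)   ≤⟨ *-monoˡ (<⇒≤ 0<e) (*-monoʳ-≤-nonNeg i 7b≤D) ⟩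
        e * (D * i)        ≡⟨ trans (cong (e *_) D*i≡1) (*-identityʳ e) ⟩
        e                  ∎)
    where
    open ≤-Reasoning
    D : ℚ
    D = 7ℚ * b + e
    0≤7b : 0ℚ ≤ 7ℚ * b
    0≤7b = 0≤* {7ℚ} (nonNegative⁻¹ 7ℚ) (<⇒≤ 0<b)
    instance
      D>0 : Positive D
      D>0 = positive (+-mono-≤-< 0≤7b 0<e)
      D≢0 : NonZero D
      D≢0 = pos⇒nonZero D
    i : ℚ
    i = 1/ D
    i>0 : Positive i
    i>0 = 1/pos⇒pos D
    instance
      i≥0 : NonNegative i
      i≥0 = pos⇒nonNeg i {{i>0}}
    D*i≡1 : D * i ≡ 1ℚ
    D*i≡1 = *-inverseʳ D
    e≤D : e ≤ D
    e≤D = ≤-trans (≤-reflexive (sym (+-identityˡ e))) (+-monoˡ-≤ e 0≤7b)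
    7b≤D : 7ℚ * b ≤ D
    7b≤D = ≤-trans (≤-reflexive (sym (+-identityʳ (7ℚ * b)))) (+-monoʳ-≤ (7ℚ * b) (<⇒≤ 0<e))
    rearrange : ∀ e i b → 7ℚ * (e * i) * b ≡ e * (7ℚ * b * i)
    rearrange = solve 3 (λ e i b → con 7ℚ :* (e :* i) :* b := e :* (con 7ℚ :* b :* i)) refl
      where open +-*-Solver

open import Defs
open import Data.Integer.Base using (+_)
open import Data.Nat.Base using (NonZero)
open import Data.Nat.Properties using (m^n≢0)

-- Termwise reduction of the reals to the rationals

module _ (n : ℕ) where

  at : ℝ → ℚ
  at x = seq x n

  at-∑ : ∀ {k} (f : Fin k → ℝ) → at (∑ f) ≡ Rat.sum (λ i → at (f i))
  at-∑ {zero}  f = refl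
  at-∑ {suc k} f = cong (at (f zero) ℚ.+_) (at-∑ (f ∘ suc))

  at-∑-cong : ∀ {k} {f : Fin k → ℝ} {g} → (∀ i → at (f i) ≡ g i) → at (∑ f) ≡ Rat.sum g
  at-∑-cong {f = f} f≗g = trans (at-∑ f) (Rat.sum-cong-≗ f≗g)

  -- Insertion by minima and maxima acts termwise on reals, even where the terms are ordered
  -- differently from their limits.
  at-insert : ∀ {k} x (ys : Vec ℝ k) →
              Vec.map at (insert x ys) ≡ Rat.insert (at x) (Vec.map at ys)
  at-insert x []       = refl
  at-insert x (y ∷ ys) = cong (at x ℚ.⊓ at y ∷_) (at-insert (x ⊔ y) ys)

  at-sort : ∀ {k} (xs : Vec ℝ k) → Vec.map at (sort xs) ≡ Rat.sort (Vec.map at xs)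
  at-sort []       = refl
  at-sort (x ∷ xs) = trans (at-insert x (sort xs)) (cong (Rat.insert (at x)) (at-sort xs))

  at-median : ∀ {k} (xs : Vec ℝ (suc k)) → at (median xs) ≡ Rat.median (Vec.map at xs)
  at-median {k} xs = trans (sym (Vecₚ.lookup-map middle at (sort xs)))
    (cong (λ ys → lookup ys middle) (at-sort xs))
    where
    middle : Fin (suc k)
    middle = fromℕ< (s≤s (ℕₚ.⌊n/2⌋≤n k))

  at-mean : ∀ xs → at (mean xs) ≡ Rat.mean (List.map at xs)
  at-mean []       = refl
  at-mean (x ∷ xs) = cong₂ (λ k s → (+ 1 ℚ./ suc k) ℚ.* (at x ℚ.+ s))
    (sym (Listₚ.length-map at xs)) (at-foldr xs)
    where
    at-foldr : ∀ xs → at (List.foldr _+_ 0ℝ xs) ≡ Rat.sumₗ (List.map at xs)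
    at-foldr []       = refl
    at-foldr (x ∷ xs) = cong (at x ℚ.+_) (at-foldr xs)

  at-±1 : ∀ s → at (±1 s) ≡ Rat.sgn s
  at-±1 Sign.+ = refl
  at-±1 Sign.- = refl

  at-if : ∀ b x → at (if b then x else 0ℝ) ≡ (if b then at x else 0ℚ)
  at-if true  x = refl
  at-if false x = refl

  module _ {U r : ℕ} (x : Fin U → ℝ) where

    at-rowEstimate : ∀ {ℓ} (ω : Outcome ℓ U r) a u → let open Outcome ω in
      at (rowEstimate x ω a u) ≡ Rat.rowEstimate (lookup hashes a) (lookup signs a) (at ∘ x) u
    at-rowEstimate ω a u = cong₂ ℚ._*_ (at-±1 (lookup (lookup (Outcome.signs ω) a) u))
      (at-∑-cong {U} λ w → trans (at-if (does (Outcome.h ω a w ≟ Outcome.h ω a u)) _)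
        (cong (λ p → if does (lookup (lookup (Outcome.hashes ω) a) w ≟ lookup (lookup (Outcome.hashes ω) a) u)
                     then p ℚ.* at (x w) else 0ℚ)
          (at-±1 (lookup (lookup (Outcome.signs ω) a) w))))

    at-err : ∀ {ℓ} (ω : Outcome (suc ℓ) U r) u → let open Outcome ω in
      at (err x ω u) ≡ Rat.median (tabulate (λ a → Rat.noise (lookup hashes a) (lookup signs a) (at ∘ x) u))
    at-err ω u = begin
      at (median (tabulate (λ a → rowEstimate x ω a u))) ℚ.- at (x u)
        ≡⟨ cong (ℚ._- at (x u)) (trans (at-median (tabulate (λ a → rowEstimate x ω a u)))
             (cong Rat.median (sym (Vecₚ.tabulate-∘ at (λ a → rowEstimate x ω a u))))) ⟩
      Rat.median (tabulate (λ a → at (rowEstimate x ω a u))) ℚ.- at (x u)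
        ≡⟨ Rat.median-tabulate-shift (λ a → at (rowEstimate x ω a u)) (at (x u)) ⟩
      Rat.median (tabulate (λ a → at (rowEstimate x ω a u) ℚ.- at (x u)))
        ≡⟨ cong Rat.median (Vecₚ.tabulate-cong λ a → trans (cong (ℚ._- at (x u)) (at-rowEstimate ω a u))
             (Rat.rowEstimate-error (lookup (Outcome.hashes ω) a) (lookup (Outcome.signs ω) a) (at ∘ x) u)) ⟩
      Rat.median (tabulate (λ a → Rat.noise (lookup (Outcome.hashes ω) a) (lookup (Outcome.signs ω) a) (at ∘ x) u)) ∎
      where open ≡-Reasoning

    at-err₅ : ∀ (ω : Outcome 5 U r) u →
              at (err x ω u) ≡ Rat.error (at ∘ x) (Outcome.hashes ω) (Outcome.signs ω) u
    at-err₅ ω u = trans (at-err ω u) (sym (Rat.median₅-tabulate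
      (λ a → Rat.noise (lookup (Outcome.hashes ω) a) (lookup (Outcome.signs ω) a) (at ∘ x) u)))

at-𝔼 : ∀ {U r} (x : Fin U → ℝ) {u v} (u≢v : u ≢ v) n →
  seq (𝔼 (λ (ω : Outcome 5 U r) → err x ω u * err x ω v)) n ≡
    Rat.mean (List.map (Rat.errors {r} (λ w → seq (x w) n) u≢v) (outcomes 5 U r))
at-𝔼 {U} {r} x {u} {v} u≢v n = trans (at-mean n (List.map f Ω)) (cong Rat.mean (trans
  (sym (Listₚ.map-∘ Ω))
  (Listₚ.map-cong (λ ω → cong₂ ℚ._*_ (at-err₅ n x ω u) (at-err₅ n x ω v)) Ω)))
  where
  Ω = outcomes 5 U r
  f : Outcome 5 U r → ℝ
  f ω = err x ω u * err x ω v

-- Both sides are built from termwise operations, so the rational bound applies at every index, with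
-- no error term and no limit.
∣𝔼∣≤ : ∀ {U} r (x : Fin U → ℝ) {u v} → u ≢ v → ∀ n → let R = + r ℚ./ 1 in
  R ℚ.* (R ℚ.* R) ℚ.* seq ∣ 𝔼 (λ (ω : Outcome 5 U r) → err x ω u * err x ω v) ∣ n
    ℚ.≤ Rat.70ℚ ℚ.* seq (‖ x ‖₁ ^ 2) n
∣𝔼∣≤ r x u≢v n = ℚₚ.≤-trans
  (ℚₚ.≤-reflexive (cong (λ m → R ℚ.* (R ℚ.* R) ℚ.* ℚ.∣ m ∣) (at-𝔼 x u≢v n)))
  (ℚₚ.≤-trans (Rat.∣mean-errors∣≤ {r} (λ w → seq (x w) n) u≢v)
    (ℚₚ.≤-reflexive (cong (Rat.70ℚ ℚ.*_) (cong₂ ℚ._*_ norm (trans norm (sym (ℚₚ.*-identityʳ (seq ‖ x ‖₁ n))))))))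
  where
  R = + r ℚ./ 1
  norm : Rat.sum (λ w → ℚ.∣ seq (x w) n ∣) ≡ seq ‖ x ‖₁ n
  norm = sym (at-∑ n (λ w → ∣ x w ∣))

-- From inequalities of terms to inequalities of reals

eventually-bounded : ∀ x → ∃[ b ] (0ℚ ℚ.< b × ∃[ N ] (∀ n → N ℕ.≤ n → seq x n ℚ.≤ b))
eventually-bounded x with cauchy x 1ℚ (ℚₚ.positive⁻¹ 1ℚ)
... | N , close = ℚ.∣ seq x N ∣ ℚ.+ 1ℚ
  , ℚₚ.+-mono-≤-< (ℚₚ.0≤∣p∣ (seq x N)) (ℚₚ.positive⁻¹ 1ℚ)
  , N , λ n N≤n → ℚₚ.≤-trans (ℚₚ.≤-reflexive (split (seq x n) (seq x N)))
      (ℚₚ.+-mono-≤ (Rat.p≤∣p∣ (seq x N)) (ℚₚ.≤-trans (Rat.p≤∣p∣ _) (close n N N≤n ℕₚ.≤-refl)))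
  where
  split : ∀ p q → p ≡ q ℚ.+ (p ℚ.- q)
  split = solve 2 (λ p q → p := q :+ (p :- q)) refl
    where open +-*-Solver

0≤‖‖² : ∀ {U} (x : Fin U → ℝ) n → 0ℚ ℚ.≤ seq (‖ x ‖₁ ^ 2) n
0≤‖‖² x n = Rat.0≤* 0≤‖x‖ (Rat.0≤* 0≤‖x‖ (ℚₚ.nonNegative⁻¹ 1ℚ))
  where
  0≤‖x‖ : 0ℚ ℚ.≤ seq ‖ x ‖₁ n
  0≤‖x‖ = subst (0ℚ ℚ.≤_) (sym (at-∑ n (λ w → ∣ x w ∣))) (Rat.sum-0≤ λ w → ℚₚ.0≤∣p∣ (seq (x w) n))

-- The argument of type `Fin U` excludes the empty universe, where even without buckets there is one
-- outcome.
𝔼-no-buckets : ∀ {ℓ U} → Fin U → (f : Outcome (suc ℓ) U 0 → ℝ) → 𝔼 f ≡ 0ℝ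
𝔼-no-buckets {U = suc _} _ _ = refl

module _ {C S : ℝ} (0≤S : ∀ n → 0ℚ ℚ.≤ seq S n) where

  ≤-cubic : ∀ (r : ℕ) .{{_ : NonZero r}} →
    (∀ n → let R = + r ℚ./ 1 in R ℚ.* (R ℚ.* R) ℚ.* seq C n ℚ.≤ Rat.70ℚ ℚ.* seq S n) →
    C ≤ fromℚ (ℚ._/_ (+ 70) (r ℕ.^ 3) {{m^n≢0 r 3}}) * S
  ≤-cubic r R³C≤70S e 0<e = 0 , λ n _ → ℚₚ.≤-trans
    (ℚₚ.*-cancelˡ-≤-pos R³ {{ℚₚ.normalize-pos (r ℕ.^ 3) 1 {{_}} {{m^n≢0 r 3}}}}
      (ℚₚ.≤-trans (scaled n) (ℚₚ.≤-reflexive (unscale (seq S n)))))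
    (ℚₚ.≤-trans (ℚₚ.≤-reflexive (sym (ℚₚ.+-identityʳ (q ℚ.* seq S n)))) (ℚₚ.+-monoʳ-≤ (q ℚ.* seq S n) (ℚₚ.<⇒≤ 0<e)))
    where
    R³ q : ℚ
    R³ = + (r ℕ.^ 3) ℚ./ 1
    q  = ℚ._/_ (+ 70) (r ℕ.^ 3) {{m^n≢0 r 3}}
    scaled : ∀ n → R³ ℚ.* seq C n ℚ.≤ Rat.70ℚ ℚ.* seq S n
    scaled n = subst (λ R³ → R³ ℚ.* seq C n ℚ.≤ Rat.70ℚ ℚ.* seq S n) (sym (Rat./1-cube r)) (R³C≤70S n)
    unscale : ∀ s → Rat.70ℚ ℚ.* s ≡ R³ ℚ.* (q ℚ.* s)
    unscale s = trans (cong (ℚ._* s)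
        (trans (sym (Rat./-* (+ 70) (r ℕ.^ 3) {{m^n≢0 r 3}})) (ℚₚ.*-comm q R³)))
      (ℚₚ.*-assoc R³ q s)

  module _ (ε : ℝ) (d : ℚ) (0<d : 0ℚ ℚ.< d) (N₀ : ℕ)
           (0+d≤ε : ∀ n → N₀ ℕ.≤ n → 0ℚ ℚ.+ d ℚ.≤ seq ε n) where

    private
      ε>0 : 0ℝ < ε
      ε>0 = d , 0<d , N₀ , 0+d≤ε
      T : ℝ
      T = fromℕ 70 * ε ^ 3 * S
      d≤ε : ∀ n → N₀ ℕ.≤ n → d ℚ.≤ seq ε n
      d≤ε n N₀≤n = subst (ℚ._≤ seq ε n) (ℚₚ.+-identityˡ d) (0+d≤ε n N₀≤n)
      0≤ε : ∀ n → N₀ ℕ.≤ n → 0ℚ ℚ.≤ seq ε n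
      0≤ε n N₀≤n = ℚₚ.≤-trans (ℚₚ.<⇒≤ 0<d) (d≤ε n N₀≤n)
      0≤T : ∀ n → N₀ ℕ.≤ n → 0ℚ ℚ.≤ seq T n
      0≤T n N₀≤n = Rat.0≤* (Rat.0≤* {Rat.70ℚ} (ℚₚ.nonNegative⁻¹ Rat.70ℚ)
        (Rat.0≤* t (Rat.0≤* t (Rat.0≤* t (ℚₚ.nonNegative⁻¹ 1ℚ))))) (0≤S n)
        where t = 0≤ε n N₀≤n
      -- From `N₀` on, the truncation at `d` built into the reciprocal is inactive, because the
      -- terms of ε are at least `d`.
      ε*ε⁻¹≡1 : ∀ n → N₀ ℕ.≤ n → seq ε n ℚ.* seq (ε ⁻¹⟨ ε>0 ⟩) n ≡ 1ℚ
      ε*ε⁻¹≡1 n N₀≤n = trans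
        (cong (ℚ._* seq (ε ⁻¹⟨ ε>0 ⟩) n) (sym (ℚₚ.p≥q⇒p⊔q≡p (d≤ε n N₀≤n))))
        (ℚₚ.*-inverseʳ (seq ε n ℚ.⊔ d) {{ℚ.>-nonZero (ℚₚ.<-≤-trans 0<d (ℚₚ.p≤q⊔p (seq ε n) d))}})
      1≤r : ∀ k → 1ℚ ℚ.≤ + suc k ℚ./ 1
      1≤r k = subst (1ℚ ℚ.≤_) (sym (Rat./1-+ 1 k))
        (ℚₚ.≤-trans (ℚₚ.≤-reflexive (sym (ℚₚ.+-identityʳ 1ℚ)))
          (ℚₚ.+-monoʳ-≤ 1ℚ (ℚₚ.nonNegative⁻¹ (+ k ℚ./ 1) {{ℚₚ.normalize-nonNeg k 1}})))
      regroup : ∀ t X² → t ℚ.* (t ℚ.* t) ℚ.* (Rat.70ℚ ℚ.* X²) ≡ Rat.70ℚ ℚ.* (t ℚ.* (t ℚ.* (t ℚ.* 1ℚ))) ℚ.* X²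
      regroup = solve 2 (λ t X² → t :* (t :* t) :* (con Rat.70ℚ :* X²)
                                := con Rat.70ℚ :* (t :* (t :* (t :* con 1ℚ))) :* X²) refl
        where open +-*-Solver

    -- Serves r = 0, where there are no outcomes: the left side is 0 and the right side is
    -- eventually nonnegative.
    ≤-ceiling-zero : (∀ n → seq C n ≡ 0ℚ) → C ≤ fromℕ 70 * ε ^ 3 * S
    ≤-ceiling-zero C≡0 e 0<e = N₀ , λ n N₀≤n → ℚₚ.≤-trans (ℚₚ.≤-reflexive (C≡0 n))
      (Rat.0≤+ (0≤T n N₀≤n) (ℚₚ.<⇒≤ 0<e))

    -- The order of choice matters: first an eventual bound b of the right side, then θ from b and
    -- e, and only then the index, which depends on θ.
    ≤-ceiling : ∀ k → IsCeiling (ε ⁻¹⟨ ε>0 ⟩) (suc k) →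
      (∀ n → let R = + suc k ℚ./ 1 in R ℚ.* (R ℚ.* R) ℚ.* seq C n ℚ.≤ Rat.70ℚ ℚ.* seq S n) →
      C ≤ fromℕ 70 * ε ^ 3 * S
    ≤-ceiling k (_ , 1/ε≤r) R³C≤70S e 0<e = choose-slack (eventually-bounded T)
      where
      Bounded : ℚ → Set
      Bounded b = ∃[ N ] (∀ n → N ℕ.≤ n → seq T n ℚ.≤ b)
      eventually : ∀ n → N₀ ℕ.≤ n → ∀ b θ → 0ℚ ℚ.≤ θ → θ ℚ.≤ 1ℚ → Rat.7ℚ ℚ.* θ ℚ.* b ℚ.≤ e →
        seq T n ℚ.≤ b → seq (ε ⁻¹⟨ ε>0 ⟩) n ℚ.≤ + suc k ℚ./ 1 ℚ.+ θ →
        seq C n ℚ.≤ seq T n ℚ.+ e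
      eventually n N₀≤n b θ 0≤θ θ≤1 7θb≤e T≤b 1/ε≤r+θ = begin
        seq C n
          ≤⟨ Rat.cube-≤ {t} {+ suc k ℚ./ 1} (0≤ε n N₀≤n) (1≤r k) 0≤θ θ≤1
               (Rat.0≤* {Rat.70ℚ} (ℚₚ.nonNegative⁻¹ Rat.70ℚ) (0≤S n)) 1≤ε*[r+θ]
               (R³C≤70S n) ⟩
        t ℚ.* (t ℚ.* t) ℚ.* (Rat.70ℚ ℚ.* s) ℚ.+ Rat.7ℚ ℚ.* θ ℚ.* (t ℚ.* (t ℚ.* t) ℚ.* (Rat.70ℚ ℚ.* s))
          ≡⟨ cong (λ s → s ℚ.+ Rat.7ℚ ℚ.* θ ℚ.* s) (regroup t s) ⟩
        seq T n ℚ.+ Rat.7ℚ ℚ.* θ ℚ.* seq T n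
          ≤⟨ ℚₚ.+-monoʳ-≤ (seq T n) (ℚₚ.≤-trans
               (Rat.*-monoˡ (Rat.0≤* {Rat.7ℚ} (ℚₚ.nonNegative⁻¹ Rat.7ℚ) 0≤θ) T≤b) 7θb≤e) ⟩
        seq T n ℚ.+ e ∎
        where
        open ℚₚ.≤-Reasoning
        t s : ℚ
        t  = seq ε n
        s  = seq S n
        1≤ε*[r+θ] : 1ℚ ℚ.≤ t ℚ.* (+ suc k ℚ./ 1 ℚ.+ θ)
        1≤ε*[r+θ] = ℚₚ.≤-trans (ℚₚ.≤-reflexive (sym (ε*ε⁻¹≡1 n N₀≤n)))
          (Rat.*-monoˡ (0≤ε n N₀≤n) 1/ε≤r+θ)
      choose-index : ∀ {b θ} → 0ℚ ℚ.≤ θ → θ ℚ.≤ 1ℚ → Rat.7ℚ ℚ.* θ ℚ.* b ℚ.≤ e → Bounded b →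
        ∃[ N ] (∀ n → N ℕ.≤ n → seq (ε ⁻¹⟨ ε>0 ⟩) n ℚ.≤ + suc k ℚ./ 1 ℚ.+ θ) →
        ∃[ N ] (∀ n → N ℕ.≤ n → seq C n ℚ.≤ seq T n ℚ.+ e)
      choose-index {b} {θ} 0≤θ θ≤1 7θb≤e (N₁ , T≤b) (N₂ , 1/ε≤r+θ) = N₀ ℕ.⊔ (N₁ ℕ.⊔ N₂) , λ n N≤n →
        let N₁₂≤n = ℕₚ.m⊔n≤o⇒n≤o N₀ (N₁ ℕ.⊔ N₂) N≤n
        in  eventually n (ℕₚ.m⊔n≤o⇒m≤o N₀ (N₁ ℕ.⊔ N₂) N≤n) b θ 0≤θ θ≤1 7θb≤e
              (T≤b n (ℕₚ.m⊔n≤o⇒m≤o N₁ N₂ N₁₂≤n))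
              (1/ε≤r+θ n (ℕₚ.m⊔n≤o⇒n≤o N₁ N₂ N₁₂≤n))
      choose-θ : ∀ {b} → Bounded b → ∃[ θ ] (0ℚ ℚ.< θ × θ ℚ.≤ 1ℚ × Rat.7ℚ ℚ.* θ ℚ.* b ℚ.≤ e) →
        ∃[ N ] (∀ n → N ℕ.≤ n → seq C n ℚ.≤ seq T n ℚ.+ e)
      choose-θ bounded (θ , 0<θ , θ≤1 , 7θb≤e) =
        choose-index (ℚₚ.<⇒≤ 0<θ) θ≤1 7θb≤e bounded (1/ε≤r θ 0<θ)
      choose-slack : ∃[ b ] (0ℚ ℚ.< b × Bounded b) → ∃[ N ] (∀ n → N ℕ.≤ n → seq C n ℚ.≤ seq T n ℚ.+ e)
      choose-slack (b , 0<b , bounded) = choose-θ bounded (Rat.slack 0<b 0<e)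

module _ {U : ℕ} (x : Fin U → ℝ) (u v : Fin U) (u≢v : u ≢ v) where

  ∣𝔼∣≤-buckets : ∀ (r : ℕ) .{{_ : NonZero r}} →
    ∣ 𝔼 (λ (ω : Outcome 5 U r) → err x ω u * err x ω v) ∣
      ≤ fromℚ (ℚ._/_ (+ 70) (r ℕ.^ 3) {{m^n≢0 r 3}}) * ‖ x ‖₁ ^ 2
  ∣𝔼∣≤-buckets r = ≤-cubic
    {∣ 𝔼 (λ (ω : Outcome 5 U r) → err x ω u * err x ω v) ∣} {‖ x ‖₁ ^ 2}
    (0≤‖‖² x) r (∣𝔼∣≤ r x u≢v)

  ∣𝔼∣≤-ε : ∀ (ε : ℝ) (ε>0 : 0ℝ < ε) (r : ℕ) → IsCeiling (ε ⁻¹⟨ ε>0 ⟩) r →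
    ∣ 𝔼 (λ (ω : Outcome 5 U r) → err x ω u * err x ω v) ∣
      ≤ fromℕ 70 * ε ^ 3 * ‖ x ‖₁ ^ 2
  ∣𝔼∣≤-ε ε (d , 0<d , N₀ , 0+d≤ε) zero _ = ≤-ceiling-zero
    {∣ 𝔼 (λ (ω : Outcome 5 U zero) → err x ω u * err x ω v) ∣} {‖ x ‖₁ ^ 2}
    (0≤‖‖² x) ε d 0<d N₀ 0+d≤ε
    λ n → cong (λ c → ℚ.∣ seq c n ∣) (𝔼-no-buckets u (λ (ω : Outcome 5 U zero) → err x ω u * err x ω v))
  ∣𝔼∣≤-ε ε (d , 0<d , N₀ , 0+d≤ε) (suc k) c = ≤-ceiling
    {∣ 𝔼 (λ (ω : Outcome 5 U (suc k)) → err x ω u * err x ω v) ∣} {‖ x ‖₁ ^ 2}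
    (0≤‖‖² x) ε d 0<d N₀ 0+d≤ε k c (∣𝔼∣≤ (suc k) x u≢v)

theoremA1 : ∀ {U : ℕ} (x : Fin U → ℝ) (u v : Fin U) → u ≢ v →
    (∀ (r : ℕ) .{{_ : NonZero r}} →
    ∣ 𝔼 (λ (ω : Outcome 5 U r) → err x ω u * err x ω v) ∣
    ≤ fromℚ (ℚ._/_ (+ 70) (r ℕ.^ 3) {{m^n≢0 r 3}}) * ‖ x ‖₁ ^ 2)
    × (∀ (ε : ℝ) (ε>0 : 0ℝ < ε) (r : ℕ) → IsCeiling (ε ⁻¹⟨ ε>0 ⟩) r →
    ∣ 𝔼 (λ (ω : Outcome 5 U r) → err x ω u * err x ω v) ∣
    ≤ fromℕ 70 * ε ^ 3 * ‖ x ‖₁ ^ 2)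
theoremA1 x u v u≢v = ∣𝔼∣≤-buckets x u v u≢v , ∣𝔼∣≤-ε x u v u≢v
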